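{- Let $T$ be a tree of order $n$ and let $k\geq 3$ be an integer such that $k<\mathrm{rad}(T)$. Then $$\gamma_{B_k}(T)\leq \left\lceil \frac{k+2}{k+1}\cdot\frac{n}{3}\right\rceil.$$
   Context: $d(u,v)$ denotes the distance in the graph; $\mathrm{rad}(T)$ is the radius (minimum eccentricity of a vertex). For a connected graph $G$ and an integer $k\ge 1$, a function $f\colon V(G)\to\{0,1,\dots,k\}$ is a dominating $k$-broadcast on $G$ if for every $u\in V(G)$ there is a vertex $v$ with $f(v)\geq 1$ and $d(u,v)\leq f(v)$. Its cost is $\omega(f)=\sum_{u\in V(G)}f(u)$, and the dominating $k$-broadcast number $\gamma_{B_k}(G)$ is the minimum cost of a dominating $k$-broadcast on $G$. -}

module Defs where

open import Level using (0ℓ)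
open import Algebra.Properties.CommutativeMonoid.Sum using ()
open import Data.Fin.Base using (Fin; zero; suc; toℕ; fromℕ; fromℕ<; inject₁; finToFun; funToFin)
open import Data.Fin.Properties using (any?; all?; toℕ-fromℕ<; finToFun-funToFin) renaming (_≟_ to _≟ᶠ_)
open import Data.Nat.Base using (ℕ; zero; suc; _≤_; _⊔_; z≤n; s≤s)
open import Data.Nat.Properties using (_≟_; _≤?_; ≤-reflexive; ≤-trans; +-0-commutativeMonoid)
open import Data.Product.Base using (∃; ∃-syntax; _×_; _,_; proj₁; proj₂)
open import Data.Vec.Functional using (foldr)
open import Function.Base using (_∘_)
open import Function.Definitions using (Injective)
open import Relation.Binary.Core using (Rel)
open import Relation.Binary.Definitions using (Symmetric; Irreflexive) renaming (Decidable to Decidable₂)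
open import Relation.Binary.PropositionalEquality using (_≡_; refl; sym; trans; cong; subst; _≗_)
open import Relation.Nullary using (¬_; Dec; yes; no; contradiction)
open import Relation.Nullary.Decidable using (map′; _×-dec_)
open import Relation.Unary using (Pred; Decidable)

open Algebra.Properties.CommutativeMonoid.Sum +-0-commutativeMonoid using (sum; sum-cong-≗)

IsMinimum : Pred ℕ 0ℓ → ℕ → Set
IsMinimum P m = P m × (∀ j → P j → m ≤ j)

minimum-below : {P : Pred ℕ 0ℓ} → Decidable P → ∀ b → P b → ∃ (IsMinimum P)
minimum-below P? zero    p = zero , p , λ _ _ → z≤n
minimum-below P? (suc b) p with P? zero
... | yes p₀ = zero , p₀ , λ _ _ → z≤n
... | no ¬p₀ with minimum-below (P? ∘ suc) b p
...   | m , pm , least = suc m , pm , λ where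
        zero    p₀ → contradiction p₀ ¬p₀
        (suc j) pj → s≤s (least j pj)

minimum : {P : Pred ℕ 0ℓ} → Decidable P → ∃ P → ∃ (IsMinimum P)
minimum P? (b , p) = minimum-below P? b p

-- A finite simple graph of order n, with vertex set Fin n.
record Graph (n : ℕ) : Set₁ where
  field
    _~_      : Rel (Fin n) 0ℓ
    _~?_     : Decidable₂ _~_
    ~-sym    : Symmetric _~_
    ~-irrefl : Irreflexive _≡_ _~_

module _ {n : ℕ} (G : Graph n) where
  open Graph G

  -- Walk d u v: a walk with d edges from u to v.
  data Walk : ℕ → Fin n → Fin n → Set where
    nil  : ∀ {u} → Walk 0 u u
    cons : ∀ {d u w v} → u ~ w → Walk d w v → Walk (suc d) u v

  walk? : ∀ d u v → Dec (Walk d u v)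
  walk? zero    u v = map′ (λ { refl → nil }) (λ { nil → refl }) (u ≟ᶠ v)
  walk? (suc d) u v = map′ (λ (_ , e , p) → cons e p) (λ { (cons e p) → _ , e , p })
                           (any? λ w → (u ~? w) ×-dec walk? d w v)

  record Connected : Set where
    field
      nonempty : Fin n
      walk     : ∀ u v → ∃[ d ] Walk d u v

  -- A cycle c₀, c₁, …, c_ℓ (then back to c₀) of length ℓ + 1 ≥ 3 on distinct vertices.
  record Cycle : Set where
    field
      ℓ      : ℕ
      2≤ℓ    : 2 ≤ ℓ
      vertex : Fin (suc ℓ) → Fin n
      inj    : Injective _≡_ _≡_ vertex
      step   : ∀ (i : Fin ℓ) → vertex (inject₁ i) ~ vertex (suc i)
      close  : vertex (fromℕ ℓ) ~ vertex zero

  record IsTree : Set where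
    field
      connected : Connected
      acyclic   : ¬ Cycle

module _ {n : ℕ} (G : Graph n) (conn : Connected G) where
  open Connected conn

  distance : ∀ u v → ∃ (IsMinimum λ d → Walk G d u v)
  distance u v = minimum (λ d → walk? G d u v) (walk u v)

  dist : Fin n → Fin n → ℕ
  dist u v = proj₁ (distance u v)

  ecc : Fin n → ℕ
  ecc u = foldr _⊔_ 0 (dist u)

  radius : ∃ (IsMinimum λ r → ∃[ v ] ecc v ≡ r)
  radius = minimum (λ r → any? λ v → ecc v ≟ r) (ecc nonempty , nonempty , refl)

  rad : ℕ
  rad = proj₁ radius

  Dominating : ∀ {k} → (Fin n → Fin (suc k)) → Set
  Dominating f = ∀ u → ∃[ v ] (1 ≤ toℕ (f v) × dist u v ≤ toℕ (f v))

  cost : ∀ {k} → (Fin n → Fin (suc k)) → ℕ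
  cost f = sum (toℕ ∘ f)

  HasBroadcastOfCost : ℕ → ℕ → Set
  HasBroadcastOfCost k c = ∃[ f ] (Dominating {k} f × cost f ≡ c)

  dominating? : ∀ {k} (f : Fin n → Fin (suc k)) → Dec (Dominating f)
  dominating? f = all? λ u → any? λ v → (1 ≤? toℕ (f v)) ×-dec (dist u v ≤? toℕ (f v))

  Dominating-resp-≗ : ∀ {k} {f g : Fin n → Fin (suc k)} → f ≗ g → Dominating f → Dominating g
  Dominating-resp-≗ f≗g dom u with dom u
  ... | v , p , q = v , subst (λ x → 1 ≤ toℕ x) (f≗g v) p
                      , subst (λ x → dist u v ≤ toℕ x) (f≗g v) q

  hasBroadcastOfCost? : ∀ k c → Dec (HasBroadcastOfCost k c)
  hasBroadcastOfCost? k c =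
    map′ (λ (i , p) → finToFun i , p)
         (λ (f , dom , eq) → funToFin f
           , Dominating-resp-≗ (sym ∘ finToFun-funToFin f) dom
           , trans (sum-cong-≗ (cong toℕ ∘ finToFun-funToFin f)) eq)
         (any? λ i → dominating? (finToFun i) ×-dec (cost (finToFun i) ≟ c))

  -- Existence is witnessed by the constant function 1.
  broadcastNumber : ∀ k → 1 ≤ k → ∃ (IsMinimum (HasBroadcastOfCost k))
  broadcastNumber k 1≤k =
    minimum (hasBroadcastOfCost? k) (cost one , one , dominating , refl)
    where
    one : Fin n → Fin (suc k)
    one _ = fromℕ< (s≤s 1≤k)

    1≤one : 1 ≤ toℕ (fromℕ< (s≤s 1≤k))
    1≤one = ≤-reflexive (sym (toℕ-fromℕ< (s≤s 1≤k)))

    dominating : Dominating one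
    dominating u = u , 1≤one , ≤-trans (proj₂ (proj₂ (distance u u)) 0 nil) z≤n

  γB : ∀ k → 1 ≤ k → ℕ
  γB k 1≤k = proj₁ (broadcastNumber k 1≤k)

{-# OPTIONS --safe #-}
module Submission where

-- Every connected graph has a spanning tree and k-broadcasts only need upper bounds on
-- distances, so it is enough to treat a rooted tree, from the leaves upwards. Finished pieces
-- with m vertices are paid for by c with 3(k+1)c ≤ (k+2)m; equivalently 3c = m + x, where an
-- excess x is affordable as soon as m ≥ x(k+1). What is not yet paid for below a vertex v is a
-- single block that one ball of radius ρ covers, with 3ρ = m + 2 (type A) or 3ρ = m + 1
-- (type B), and too small for that excess. As 2ρ exceeds the height of the block, the ball also
-- covers the parent of v, and larger balls reach further up by two steps per unit of radius.
-- At a vertex z whose children carry blocks, let a and b be the two tallest ones.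
-- * If one ball of radius at most k centred on the long path of a reaches as far as b, it covers
--   everything at z; the result is affordable or again a block of type A or B.
-- * Otherwise the vertices at z are numerous enough to afford an excess of 2 (or 3, if all
--   blocks have type A). Each block of type A is peeled: outside a certain distance D of z it is
--   covered at a cost c with 3(c + D) = m + 5. One ball, at z or on the tallest block of type B,
--   covers what remains.
-- The last block at the root has excess at most 2, which the ceiling absorbs.

open import Defs
open import Level using (0ℓ)
open import Data.Empty using (⊥-elim)
open import Algebra.Properties.CommutativeMonoid.Sum using ()
open import Data.Fin.Base using (Fin; zero; suc; toℕ; fromℕ<)
open import Data.Fin.Properties using (all?; ¬∀⟶∃¬; injective⇒≤; toℕ-fromℕ<)
import Data.Fin.Properties as Fin
open import Data.List.Base using (List; []; _∷_; _++_; map; length; lookup)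
open import Data.List.Relation.Unary.All using (All)
import Data.List.Relation.Unary.All as All
import Data.List.Relation.Unary.All.Properties as All
open import Data.List.Relation.Unary.AllPairs using (AllPairs)
import Data.List.Relation.Unary.AllPairs as AllPairs
open import Data.List.Relation.Unary.Any using (Any; here; there)
import Data.List.Relation.Unary.Any.Properties as Any
open import Data.List.Properties using (map-++; length-++)
open import Data.List.Membership.Propositional using (_∈_)
open import Data.List.Membership.Propositional.Properties using (∈-++⁻; ∈-++⁺ˡ; ∈-lookup)
open import Data.List.Membership.DecPropositional using (_∈?_)
open import Data.List.Relation.Binary.Permutation.Propositional using (_↭_; swap; ↭-refl; ↭-sym; ↭-trans; ↭⇒↭ₛ)
open import Data.List.Relation.Binary.Permutation.Propositional.Properties using (++⁺ˡ; ++⁺ʳ; shift; ↭-length)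
open import Data.List.Relation.Binary.Permutation.Setoid.Properties using (Unique-resp-↭)
open import Data.List.Relation.Unary.All.Properties using (¬Any⇒All¬)
open import Data.List.Relation.Unary.Unique.Propositional using (Unique)
open import Data.Nat.Base using (ℕ; zero; suc; _+_; _*_; _∸_; _⊔_; _≤_; _<_; z≤n; s≤s; s≤s⁻¹; ⌈_/2⌉)
open import Data.Nat.ListAction using (sum)
open import Data.Nat.ListAction.Properties using (sum-++)
open import Data.Nat.Properties
open import Data.Nat.Tactic.RingSolver using (solve)
open import Data.Product.Base using (∃; ∃₂; ∃-syntax; _×_; _,_; proj₁; proj₂)
open import Data.Sum.Base using (_⊎_; inj₁; inj₂; [_,_]′)
import Data.Sum.Base as Sum
open import Relation.Binary.PropositionalEquality using (_≡_; refl; sym; trans; cong; cong₂; subst; subst₂; setoid)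
open import Relation.Nullary using (¬_; yes; no)
open import Relation.Unary using (Pred; _⊆_; _∪_; ∅; ｛_｝)

open Algebra.Properties.CommutativeMonoid.Sum +-0-commutativeMonoid using (∑-distrib-+; sum-cong-≗) renaming (sum to ∑)

-- Arithmetic of radii, sizes and heights.

infixr 4 _⊞_
_⊞_ : ∀ {a b c d} → a ≤ b → c ≤ d → a + c ≤ b + d
_⊞_ = +-mono-≤

infixr 5 _⊠_
_⊠_ : ∀ k {a b} → a ≤ b → k * a ≤ k * b
_⊠_ = *-monoʳ-≤

-- Farkas certificates: L ≤ R is a nonnegative combination of the hypotheses and of b < a, which
-- yields integer rounding as well.
linear : ∀ {a b L R} s → (b < a → L ≤ R) → L ≡ suc (R + s) → a ≤ b
linear {R = R} s h L≡ = ≮⇒≥ λ b<a → <⇒≱ (s≤s (m≤m+n R s)) (subst (_≤ R) L≡ (h b<a))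

-- The witness is the least radius that is at least `ρ` and at least half of `s`; the last disjunct
-- records its minimality, which the cost bounds use.
half : ∀ ρ s k → ρ ≤ k → s ≤ 2 * k →
  ∃[ r ] (ρ ≤ r × s ≤ 2 * r × r ≤ k × (r ≤ ρ ⊎ 2 * r ≤ suc s))
half ρ s k ρ≤k s≤2k = ρ ⊔ ⌈ s /2⌉ , m≤m⊔n ρ _
  , ≤-trans s≤ (2 ⊠ m≤n⊔m ρ ⌈ s /2⌉)
  , ⊔-lub ρ≤k (≤-trans (⌈n/2⌉-mono s≤2k) (≤-reflexive (sym (trans (n≡⌈n+n/2⌉ k) (cong (λ x → ⌈ k + x /2⌉) (sym (+-identityʳ k)))))))
  , minimal
  where
  s≤ : s ≤ 2 * ⌈ s /2⌉
  s≤ = subst₂ _≤_ (⌊n/2⌋+⌈n/2⌉≡n s) (cong (⌈ s /2⌉ +_) (sym (+-identityʳ ⌈ s /2⌉))) (+-monoˡ-≤ ⌈ s /2⌉ (⌊n/2⌋≤⌈n/2⌉ s))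
  ≤s+1 : 2 * ⌈ s /2⌉ ≤ suc s
  ≤s+1 = subst₂ _≤_ (cong (⌈ s /2⌉ +_) (sym (+-identityʳ ⌈ s /2⌉))) (⌊n/2⌋+⌈n/2⌉≡n (suc s)) (+-monoʳ-≤ ⌈ s /2⌉ (⌊n/2⌋≤⌈n/2⌉ (suc s)))
  minimal : ρ ⊔ ⌈ s /2⌉ ≤ ρ ⊎ 2 * (ρ ⊔ ⌈ s /2⌉) ≤ suc s
  minimal with ⊔-sel ρ ⌈ s /2⌉
  ... | inj₁ e = inj₁ (≤-reflexive e)
  ... | inj₂ e = inj₂ (subst (λ x → 2 * x ≤ suc s) (sym e) ≤s+1)

-- `3 * suc k * c` is at most `suc k * m + x * suc k`, and the second term is at most one more `m`.
budget : ∀ c m x k → 3 * c ≤ m + x → x * suc k ≤ m → 3 * suc k * c ≤ (k + 2) * m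
budget c m x k p q = linear 0 (λ w → w ⊞ suc k ⊠ p ⊞ q) (solve (c ∷ m ∷ x ∷ k ∷ []))

-- Used for a centre at distance `h ∸ r` from the top of a path and a point within `e` of that top:
-- the detour over the top has length at most `r`.
reach-fits : ∀ e h r → e ≤ r → h + e ≤ 2 * r → e + (h ∸ r) ≤ r
reach-fits e h r e≤r h+e≤ with ≤-total r h
... | inj₁ r≤h = split (h ∸ r) (m∸n+n≡m r≤h)
  where
  split : ∀ x → x + r ≡ h → e + x ≤ r
  split x p = linear 0 (λ w → w ⊞ h+e≤ ⊞ ≤-reflexive p) (solve (e ∷ h ∷ r ∷ x ∷ []))
... | inj₂ h≤r rewrite m≤n⇒m∸n≡0 h≤r | +-identityʳ e = e≤r

shorter-half : ∀ e h r → e ≤ h → h + e ≤ 2 * r → e ≤ r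
shorter-half e h r p q = linear 1 (λ w → 2 ⊠ w ⊞ p ⊞ q) (solve (e ∷ h ∷ r ∷ []))

1≤radius : ∀ m x ρ → m + x ≡ 3 * ρ → 1 ≤ x → 1 ≤ ρ
1≤radius m x ρ p q =
  linear m (λ w → 3 ⊠ w ⊞ ≤-reflexive p ⊞ q) (solve (m ∷ x ∷ ρ ∷ []))

radiusA≤k : ∀ m ρ k → 3 ≤ k → m + 2 ≡ 3 * ρ → m ≤ 2 * k + 1 → ρ ≤ k
radiusA≤k m ρ k 3≤k p q =
  linear 2 (λ w → 3 ⊠ w ⊞ ≤-reflexive (sym p) ⊞ q ⊞ 3≤k) (solve (m ∷ ρ ∷ k ∷ []))

radiusB≤k : ∀ m ρ k → m + 1 ≡ 3 * ρ → m ≤ k → ρ ≤ k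
radiusB≤k m ρ k p q =
  linear (2 * k + 1) (λ w → 3 ⊠ w ⊞ ≤-reflexive (sym p) ⊞ q) (solve (m ∷ ρ ∷ k ∷ []))

stem-costB : ∀ m ρ → m + 1 ≡ 3 * ρ → 3 * ρ ≤ suc (m + 0) + 0
stem-costB m ρ p = linear 0 (λ w → w ⊞ ≤-reflexive (sym p)) (solve (m ∷ ρ ∷ []))

stem-size : ∀ m ρ → m + 2 ≡ 3 * ρ → suc (m + 0) + 1 ≡ 3 * ρ
stem-size m ρ p rewrite +-identityʳ m = trans (sym (+-suc m 1)) p

double-suc : ∀ k → 2 * suc k ≡ suc (2 * k + 1)
double-suc k = solve (k ∷ [])

peel-positive : ∀ c d ρ t → c + ρ ≤ suc t → 2 + t ≤ d + 2 * c → 2 + t ≤ 2 * ρ → 1 ≤ d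
peel-positive c d ρ t p q r =
  linear 1 (λ w → w ⊞ 2 ⊠ p ⊞ q ⊞ r) (solve (c ∷ d ∷ ρ ∷ t ∷ []))

joint-radius : ∀ r ρa ρb s → r ≤ ρa ⊎ 2 * r ≤ suc s → s ≤ 2 * (ρa + ρb) → r ≤ ρa + ρb
joint-radius r ρa ρb s (inj₁ p) q = ≤-trans p (m≤m+n ρa ρb)
joint-radius r ρa ρb s (inj₂ p) q =
  linear 0 (λ w → 2 ⊠ w ⊞ p ⊞ q) (solve (r ∷ ρa ∷ ρb ∷ s ∷ []))

joint-radius-< : ∀ r ρa ρb s → r ≤ ρa ⊎ 2 * r ≤ suc s → 1 ≤ ρb → 2 + s ≤ 2 * (ρa + ρb) → r < ρa + ρb
joint-radius-< r ρa ρb s (inj₁ p) 1≤ρb q =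
  linear 0 (λ w → w ⊞ p ⊞ 1≤ρb) (solve (r ∷ ρa ∷ ρb ∷ []))
joint-radius-< r ρa ρb s (inj₂ p) 1≤ρb q =
  linear 0 (λ w → 2 ⊠ w ⊞ p ⊞ q) (solve (r ∷ ρa ∷ ρb ∷ s ∷ []))

joint-cost-< : ∀ r ρa ρb ma mb M xa xb → r < ρa + ρb → ma + xa ≡ 3 * ρa → mb + xb ≡ 3 * ρb →
  xa + xb ≤ 4 → 3 * r ≤ suc (ma + (mb + M)) + 0
joint-cost-< r ρa ρb ma mb M xa xb p qa qb q =
  linear M (λ w → w ⊞ 3 ⊠ p ⊞ ≤-reflexive (sym qa) ⊞ ≤-reflexive (sym qb) ⊞ q)
    (solve (r ∷ ρa ∷ ρb ∷ ma ∷ mb ∷ M ∷ xa ∷ xb ∷ []))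

joint-cost : ∀ r ρa ρb ma mb M xa xb y → r ≤ ρa + ρb → ma + xa ≡ 3 * ρa → mb + xb ≡ 3 * ρb →
  xa + xb ≤ suc (M + y) → 3 * r ≤ suc (ma + (mb + M)) + y
joint-cost r ρa ρb ma mb M xa xb y p qa qb q =
  linear 0 (λ w → w ⊞ 3 ⊠ p ⊞ ≤-reflexive (sym qa) ⊞ ≤-reflexive (sym qb) ⊞ q)
    (solve (r ∷ ρa ∷ ρb ∷ ma ∷ mb ∷ M ∷ xa ∷ xb ∷ y ∷ []))

joint-size : ∀ ρa ρb ma mb M xa xb y → ma + xa ≡ 3 * ρa → mb + xb ≡ 3 * ρb →
  xa + xb ≡ suc (M + y) → suc (ma + (mb + M)) + y ≡ 3 * (ρa + ρb)
joint-size ρa ρb ma mb M xa xb y qa qb q = ≤-antisym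
  (linear 0 (λ w → w ⊞ ≤-reflexive qa ⊞ ≤-reflexive qb ⊞ ≤-reflexive (sym q))
    (solve (ρa ∷ ρb ∷ ma ∷ mb ∷ M ∷ xa ∷ xb ∷ y ∷ [])))
  (linear 0 (λ w → w ⊞ ≤-reflexive (sym qa) ⊞ ≤-reflexive (sym qb) ⊞ ≤-reflexive q)
    (solve (ρa ∷ ρb ∷ ma ∷ mb ∷ M ∷ xa ∷ xb ∷ y ∷ [])))

joint-slack : ∀ ρa ρb ha xa → ha + xa ≤ suc (2 * ρa) → 1 ≤ xa → 1 ≤ ρb → 2 + ha ≤ 2 * (ρa + ρb)
joint-slack ρa ρb ha xa p q r =
  linear 0 (λ w → w ⊞ p ⊞ q ⊞ 2 ⊠ r) (solve (ρa ∷ ρb ∷ ha ∷ xa ∷ []))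

joint-heights : ∀ ρa ρb ha hb xa xb → ha + xa ≤ suc (2 * ρa) → hb + xb ≤ suc (2 * ρb) →
  ha + hb + (xa + xb) ≤ 2 + 2 * (ρa + ρb)
joint-heights ρa ρb ha hb xa xb p q =
  linear 0 (λ w → w ⊞ p ⊞ q) (solve (ρa ∷ ρb ∷ ha ∷ hb ∷ xa ∷ xb ∷ []))

joint-radius≤height : ∀ ρ ha hb → 2 * ρ ≤ suc (ha + hb) → hb ≤ ha → ρ ≤ ha
joint-radius≤height ρ ha hb p q =
  linear 0 (λ w → 2 ⊠ w ⊞ p ⊞ q) (solve (ρ ∷ ha ∷ hb ∷ []))

double-≤ : ∀ ρ a b → ρ ≤ a → ρ ≤ b → 2 * ρ ≤ a + b
double-≤ ρ a b p q = linear 0 (λ w → w ⊞ p ⊞ q) (solve (ρ ∷ a ∷ b ∷ []))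

peel-depth : ∀ c ρ ha hb d → c + ρ ≤ suc ha → ha < d + 2 * c → suc (ha + hb) ≤ 2 * ρ → hb ≤ d
peel-depth c ρ ha hb d p q r =
  linear 0 (λ w → w ⊞ 2 ⊠ p ⊞ q ⊞ r) (solve (c ∷ ρ ∷ ha ∷ hb ∷ d ∷ []))

peel-depth′ : ∀ c ρ ha hb d → c + ρ ≤ ha → ha < d + 2 * c → ha + hb ≤ 2 * ρ → hb ≤ d
peel-depth′ c ρ ha hb d p q r =
  linear 1 (λ w → w ⊞ 2 ⊠ p ⊞ q ⊞ r) (solve (c ∷ ρ ∷ ha ∷ hb ∷ d ∷ []))

peel-cost : ∀ c ρa ρb t → c + (ρa + ρb) ≤ suc t → 1 ≤ ρb → c + ρa ≤ t
peel-cost c ρa ρb t p q = linear 0 (λ w → w ⊞ p ⊞ q) (solve (c ∷ ρa ∷ ρb ∷ t ∷ []))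

full-cost : ∀ c ρ h → h ≤ c + ρ → 2 * ρ ≤ h → ρ ≤ c
full-cost c ρ h p q = linear 0 (λ w → w ⊞ p ⊞ q) (solve (c ∷ ρ ∷ h ∷ []))

tight-height : ∀ ρa ρb ha hb → 2 * (ρa + ρb) ≤ suc (ha + hb) → hb + 2 ≤ suc (2 * ρb) → 2 * ρa ≤ ha
tight-height ρa ρb ha hb p q =
  linear 0 (λ w → w ⊞ p ⊞ q) (solve (ρa ∷ ρb ∷ ha ∷ hb ∷ []))

peel-level : ∀ c d ρ h → c + ρ ≡ h → d + h ≡ 2 * ρ → h ≤ d + 2 * c
peel-level c d ρ h p q =
  linear 0 (λ w → w ⊞ 2 ⊠ ≤-reflexive (sym p) ⊞ ≤-reflexive (sym q)) (solve (c ∷ d ∷ ρ ∷ h ∷ []))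

peel-1≤ : ∀ d ρ h → h < 2 * ρ → d + h ≡ 2 * ρ → 1 ≤ d
peel-1≤ d ρ h p q = linear 0 (λ w → w ⊞ p ⊞ ≤-reflexive (sym q)) (solve (d ∷ ρ ∷ h ∷ []))

peel-≤k : ∀ d ρ t k → 2 * ρ ≤ t + k → d + suc t ≡ 2 * ρ → suc d ≤ k
peel-≤k d ρ t k p q = linear 0 (λ w → w ⊞ p ⊞ ≤-reflexive q) (solve (d ∷ ρ ∷ t ∷ k ∷ []))

-- The hypotheses give `c + d ≡ ρ`, hence `3 * (c + suc d) ≡ m + 5`; the extra 1 counts this branch
-- in the invariant `CostA`.
first-cost : ∀ c d ρ h m M → c + ρ ≡ h → d + h ≡ 2 * ρ → m + 2 ≡ 3 * ρ →
  3 * (c + 0) + (3 * suc d + 1) ≤ (m + M) + 6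
first-cost c d ρ h m M p q r =
  linear M (λ w → w ⊞ 3 ⊠ ≤-reflexive p ⊞ 3 ⊠ ≤-reflexive q ⊞ ≤-reflexive (sym r))
    (solve (c ∷ d ∷ ρ ∷ h ∷ m ∷ M ∷ []))

-- If `R` stays the maximum, `1 ≤ d` gives `3 * c < m`, a gain of one unit. If `suc d` replaces it,
-- the old `3 * R` uses up the allowance 6, so the earlier branches cost at most `M`.
next-cost : ∀ c₀ R p c d ρ h m M → c + ρ ≡ h → d + h ≡ 2 * ρ → m + 2 ≡ 3 * ρ →
  1 ≤ d → 2 ≤ R → 3 * c₀ + (3 * R + p) ≤ M + 6 → 3 * (c + c₀) + (3 * (R ⊔ suc d) + suc p) ≤ (m + M) + 6
next-cost c₀ R p c d ρ h m M e₁ e₂ e₃ 1≤d 2≤R cost with R ⊔ suc d | ⊔-sel R (suc d)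
... | _ | inj₁ refl =
  linear 0 (λ w → w ⊞ 3 ⊠ ≤-reflexive e₁ ⊞ 3 ⊠ ≤-reflexive e₂ ⊞ ≤-reflexive (sym e₃) ⊞ 3 ⊠ 1≤d ⊞ cost)
    (solve (c₀ ∷ R ∷ p ∷ c ∷ d ∷ ρ ∷ h ∷ m ∷ M ∷ []))
... | _ | inj₂ refl =
  linear 0 (λ w → w ⊞ 3 ⊠ ≤-reflexive e₁ ⊞ 3 ⊠ ≤-reflexive e₂ ⊞ ≤-reflexive (sym e₃) ⊞ 3 ⊠ 2≤R ⊞ cost)
    (solve (c₀ ∷ R ∷ p ∷ c ∷ d ∷ ρ ∷ h ∷ m ∷ M ∷ []))

heightB≤k : ∀ h ρ m k → h ≤ 2 * ρ → m + 1 ≡ 3 * ρ → m ≤ k → h ≤ k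
heightB≤k h ρ m k p q r =
  linear k (λ w → 3 ⊠ w ⊞ 3 ⊠ p ⊞ 2 ⊠ ≤-reflexive (sym q) ⊞ 2 ⊠ r) (solve (h ∷ ρ ∷ m ∷ k ∷ []))

2≤sizeB : ∀ m ρ → m + 1 ≡ 3 * ρ → 1 ≤ ρ → 2 ≤ m
2≤sizeB m ρ p q = linear 0 (λ w → w ⊞ 3 ⊠ q ⊞ ≤-reflexive (sym p)) (solve (m ∷ ρ ∷ []))

+-exchange : ∀ a b c → a + (b + c) ≡ b + (a + c)
+-exchange a b c = solve (a ∷ b ∷ c ∷ [])

pair-cost : ∀ m m′ M ρ ρ′ → m + 1 ≡ 3 * ρ → m′ + 1 ≡ 3 * ρ′ → m′ ≤ M → 3 * (ρ + ρ′) ≤ (m + M) + 2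
pair-cost m m′ M ρ ρ′ p q r =
  linear 0 (λ w → w ⊞ ≤-reflexive (sym p) ⊞ ≤-reflexive (sym q) ⊞ r) (solve (m ∷ m′ ∷ M ∷ ρ ∷ ρ′ ∷ []))

-- The four cases are the four quantities that can determine the least radius: `ρ`, `R`, half of
-- `h + h′` and half of `h + R`. In the last one, `2 ≤ R` makes `r < ρ + R`.
top-cost : ∀ r ρ R h h′ N M → 2 ≤ R → 2 ≤ M → h ≤ 2 * ρ → 3 * ρ ≤ M + 1 → h + h′ ≤ 2 * N → 3 * N ≤ M + 2 →
  r ≤ ρ ⊔ R ⊎ 2 * r ≤ suc (h + (h′ ⊔ R)) → 3 * r + 2 ≤ M + 3 * R
top-cost r ρ R h h′ N M 2≤R 2≤M h≤2ρ 3ρ≤ h≤2N 3N≤ (inj₁ r≤) with ρ ⊔ R | ⊔-sel ρ R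
... | _ | inj₁ refl = linear 3 (λ w → w ⊞ 3 ⊠ r≤ ⊞ 3ρ≤ ⊞ 3 ⊠ 2≤R) (solve (r ∷ ρ ∷ R ∷ M ∷ []))
... | _ | inj₂ refl = linear 0 (λ w → w ⊞ 3 ⊠ r≤ ⊞ 2≤M) (solve (r ∷ R ∷ M ∷ []))
top-cost r ρ R h h′ N M 2≤R 2≤M h≤2ρ 3ρ≤ h≤2N 3N≤ (inj₂ 2r≤) with h′ ⊔ R | ⊔-sel h′ R
... | _ | inj₁ refl = linear 2 (λ w → w ⊞ 3 ⊠ r≤N ⊞ 3N≤ ⊞ 3 ⊠ 2≤R) (solve (r ∷ N ∷ R ∷ M ∷ []))
  where
  r≤N : r ≤ N
  r≤N = linear 0 (λ w → 2 ⊠ w ⊞ 2r≤ ⊞ h≤2N) (solve (r ∷ N ∷ h ∷ h′ ∷ []))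
... | _ | inj₂ refl = linear 0 (λ w → w ⊞ 3 ⊠ r<ρ+R ⊞ 3ρ≤) (solve (r ∷ ρ ∷ R ∷ M ∷ []))
  where
  r<ρ+R : r < ρ + R
  r<ρ+R = linear 0 (λ w → 2 ⊠ w ⊞ 2r≤ ⊞ h≤2ρ ⊞ 2≤R) (solve (r ∷ ρ ∷ R ∷ h ∷ []))

mixed-cost : ∀ c r R p MA MB M → 3 * c + (3 * R + suc p) ≤ MA + 6 → 3 * r + 2 ≤ MB + 3 * R → MA + MB ≡ M →
  3 * (c + r) ≤ suc M + 2
mixed-cost c r R p MA MB M q₁ q₂ e =
  linear p (λ w → w ⊞ q₁ ⊞ q₂ ⊞ ≤-reflexive e) (solve (c ∷ r ∷ R ∷ p ∷ MA ∷ MB ∷ M ∷ []))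

pure-cost : ∀ c R p MA MB M → 3 * c + (3 * R + suc (suc p)) ≤ MA + 6 → MA + MB ≡ M → 3 * (c + R) ≤ suc M + 3
pure-cost c R p MA MB M q e =
  linear (p + MB) (λ w → w ⊞ q ⊞ ≤-reflexive e) (solve (c ∷ R ∷ p ∷ MA ∷ MB ∷ M ∷ []))

-- Both heights are at most `2 * ρ`, where `3 * ρ ≤ k + 1`, so their sum cannot exceed `2 * k`. The
-- conclusion is absurd and excludes a tallest block of type B.
tall-not-B : ∀ ha hb ρ m k → 2 * k < ha + hb → hb ≤ ha → ha ≤ 2 * ρ → m + 1 ≡ 3 * ρ → m ≤ k → 3 ≤ k → 1 ≤ 0
tall-not-B ha hb ρ m k p q r s u v =
  linear 4 (λ _ → 3 ⊠ p ⊞ 3 ⊠ q ⊞ 6 ⊠ r ⊞ 4 ⊠ ≤-reflexive (sym s) ⊞ 4 ⊠ u ⊞ 2 ⊠ v)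
    (solve (ha ∷ hb ∷ ρ ∷ m ∷ k ∷ []))

-- `2 * (ρa + ρb)` is at least `2 * k + 3`, so parity yields `k + 2 ≤ ρa + ρb`; the two sizes then
-- sum to at least `3 * k + 2`, and `z` is the missing vertex.
tall-AA : ∀ ha hb ρa ρb ma mb M k → 2 * k < ha + hb → suc ha ≤ 2 * ρa → suc hb ≤ 2 * ρb →
  ma + 2 ≡ 3 * ρa → mb + 2 ≡ 3 * ρb → 3 * suc k ≤ suc (ma + (mb + M))
tall-AA ha hb ρa ρb ma mb M k p qa qb ea eb =
  linear M (λ w → w ⊞ 3 ⊠ k+2≤ ⊞ ≤-reflexive (sym ea) ⊞ ≤-reflexive (sym eb))
    (solve (ρa ∷ ρb ∷ ma ∷ mb ∷ M ∷ k ∷ []))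
  where
  k+2≤ : 2 + k ≤ ρa + ρb
  k+2≤ = linear 0 (λ w → 2 ⊠ w ⊞ p ⊞ qa ⊞ qb) (solve (ha ∷ hb ∷ ρa ∷ ρb ∷ k ∷ []))

tall-AB : ∀ ha hb ρa ρb ma mb M k → 3 ≤ k → 2 * k < ha + hb → suc ha ≤ 2 * ρa → hb ≤ 2 * ρb →
  ma + 2 ≡ 3 * ρa → mb + 1 ≡ 3 * ρb → 2 * suc k ≤ suc (ma + (mb + M))
tall-AB ha hb ρa ρb ma mb M k 3≤k p qa qb ea eb =
  linear (M + 2) (λ w → w ⊞ 3 ⊠ k+1≤ ⊞ ≤-reflexive (sym ea) ⊞ ≤-reflexive (sym eb) ⊞ 3≤k)
    (solve (ρa ∷ ρb ∷ ma ∷ mb ∷ M ∷ k ∷ []))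
  where
  k+1≤ : 1 + k ≤ ρa + ρb
  k+1≤ = linear 1 (λ w → 2 ⊠ w ⊞ p ⊞ qa ⊞ qb) (solve (ha ∷ hb ∷ ρa ∷ ρb ∷ k ∷ []))

leftover-cost : ∀ c ρ d m n k → 3 * suc k * c ≤ (k + 2) * d → 3 * ρ ≤ m + 2 → d + m ≡ n →
  3 * suc k * (c + ρ) ≤ (k + 2) * n + 2 * suc k
leftover-cost c ρ d m n k p q e =
  linear m (λ w → w ⊞ p ⊞ suc k ⊠ q ⊞ (k + 2) ⊠ ≤-reflexive e) (solve (c ∷ ρ ∷ d ∷ m ∷ n ∷ k ∷ []))

closed-total : ∀ a b c → a + c + b ≡ a + b + c
closed-total a b c = solve (a ∷ b ∷ c ∷ [])

open-total : ∀ a b M m → a + b + suc (m + M) ≡ (a + suc M) + (b + m)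
open-total a b M m = solve (a ∷ b ∷ M ∷ m ∷ [])

-- `suc (2 + k * 3)` is `3 * suc k` in the form to which the denominator of the rational product
-- computes.
bound-< : ∀ γ n k → 3 * suc k * γ ≤ (k + 2) * n + 2 * suc k → suc (2 + k * 3) * γ < (k + 2) * n + suc (2 + k * 3)
bound-< γ n k p = linear k (λ w → w ⊞ p) (solve (γ ∷ n ∷ k ∷ []))

-- Sums of functions on `Fin n`, and indexing of duplicate-free lists.

∑-mono-≤ : ∀ {n} {f g : Fin n → ℕ} → (∀ i → f i ≤ g i) → ∑ f ≤ ∑ g
∑-mono-≤ {zero}  f≤g = z≤n
∑-mono-≤ {suc n} f≤g = f≤g zero ⊞ ∑-mono-≤ (λ i → f≤g (suc i))

∑-zero : ∀ n → ∑ {n} (λ _ → 0) ≡ 0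
∑-zero zero    = refl
∑-zero (suc n) = ∑-zero n

spike : ∀ {n} → Fin n → ℕ → Fin n → ℕ
spike zero    r zero    = r
spike zero    r (suc _) = 0
spike (suc w) r zero    = 0
spike (suc w) r (suc v) = spike w r v

spike-≡ : ∀ {n} (w : Fin n) r → spike w r w ≡ r
spike-≡ zero    r = refl
spike-≡ (suc w) r = spike-≡ w r

spike-≤ : ∀ {n} (w : Fin n) r v → spike w r v ≤ r
spike-≤ zero    r zero    = ≤-refl
spike-≤ zero    r (suc v) = z≤n
spike-≤ (suc w) r zero    = z≤n
spike-≤ (suc w) r (suc v) = spike-≤ w r v

∑-spike : ∀ {n} (w : Fin n) r → ∑ (spike w r) ≡ r
∑-spike {suc n} zero    r = trans (cong (r +_) (∑-zero n)) (+-identityʳ r)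
∑-spike {suc n} (suc w) r = ∑-spike w r

unique-lookup : ∀ {A : Set} {xs : List A} → Unique xs → ∀ {i j} → lookup xs i ≡ lookup xs j → i ≡ j
unique-lookup (_ AllPairs.∷ _)  {zero}  {zero}  _  = refl
unique-lookup (x≢ AllPairs.∷ _) {zero}  {suc j} eq = ⊥-elim (All.lookup x≢ (∈-lookup j) eq)
unique-lookup (x≢ AllPairs.∷ _) {suc i} {zero}  eq = ⊥-elim (All.lookup x≢ (∈-lookup i) (sym eq))
unique-lookup (_ AllPairs.∷ u)  {suc i} {suc j} eq = cong suc (unique-lookup u eq)

-- Bounded distances in the graph.

module Broadcast {n : ℕ} (G : Graph n) (k : ℕ) (3≤k : 3 ≤ k) where
  open Graph G

  V : Set
  V = Fin n

  -- A bounded walk instead of a comparison with `dist`: such bounds compose directly. `dist`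
  -- returns only in `γB≤`.
  Near : ℕ → V → V → Set
  Near d u v = ∃[ e ] (e ≤ d × Walk G e u v)

  near-refl : ∀ {d u} → Near d u u
  near-refl = 0 , z≤n , nil

  near-≤ : ∀ {d e u v} → d ≤ e → Near d u v → Near e u v
  near-≤ d≤e (i , i≤d , p) = i , ≤-trans i≤d d≤e , p

  walk-++ : ∀ {d e u v w} → Walk G d u v → Walk G e v w → Walk G (d + e) u w
  walk-++ nil        q = q
  walk-++ (cons a p) q = cons a (walk-++ p q)

  walk-sym : ∀ {d u v} → Walk G d u v → Walk G d v u
  walk-sym nil = nil
  walk-sym {u = u} {v} (cons {d} a p) =
    subst (λ i → Walk G i v u) (+-comm d 1) (walk-++ (walk-sym p) (cons (~-sym a) nil))

  near-trans : ∀ {d e u v w} → Near d u v → Near e v w → Near (d + e) u w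
  near-trans (i , i≤d , p) (j , j≤e , q) = i + j , +-mono-≤ i≤d j≤e , walk-++ p q

  near-sym : ∀ {d u v} → Near d u v → Near d v u
  near-sym (i , i≤d , p) = i , i≤d , walk-sym p

  near-up : ∀ {d u c z} → z ~ c → Near d u c → Near (suc d) u z
  near-up {d} e p = near-≤ (≤-reflexive (+-comm d 1)) (near-trans p (1 , s≤s z≤n , cons (~-sym e) nil))

  -- Partial covers and their cost.

  -- A pair (w , r) is a vertex w broadcasting with strength r.
  Valid : V × ℕ → Set
  Valid (_ , r) = 1 ≤ r × r ≤ k

  Reached : List (V × ℕ) → V → Set
  Reached bs u = Any (λ (w , r) → Near r u w) bs

  weight : List (V × ℕ) → ℕ
  weight bs = sum (map proj₂ bs)

  -- `X` holds what is left to later balls, and `c` is only an upper bound, so that covers weaken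
  -- freely.
  record Cover (P X : Pred V 0ℓ) (c : ℕ) : Set where
    field
      balls   : List (V × ℕ)
      valid   : All Valid balls
      weight≤ : weight balls ≤ c
      reach   : P ⊆ (Reached balls ∪ X)
  open Cover

  cover-weaken : ∀ {P P′ X X′ c c′} → P′ ⊆ (P ∪ X′) → X ⊆ X′ → c ≤ c′ → Cover P X c → Cover P′ X′ c′
  cover-weaken P′⊆ X⊆ c≤ C = record
    { balls   = balls C
    ; valid   = valid C
    ; weight≤ = ≤-trans (weight≤ C) c≤
    ; reach   = λ p → [ (λ q → Sum.map₂ X⊆ (reach C q)) , inj₂ ]′ (P′⊆ p)
    }

  cover-⊆ : ∀ {P X} → P ⊆ X → Cover P X 0
  cover-⊆ P⊆X = record { balls = [] ; valid = All.[] ; weight≤ = z≤n ; reach = λ p → inj₂ (P⊆X p) }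

  cover-ball : ∀ {P X r} w → 1 ≤ r → r ≤ k → P ⊆ (λ u → Near r u w ⊎ X u) → Cover P X r
  cover-ball {r = r} w 1≤r r≤k near = record
    { balls   = (w , r) ∷ []
    ; valid   = (1≤r , r≤k) All.∷ All.[]
    ; weight≤ = ≤-reflexive (+-identityʳ r)
    ; reach   = λ p → Sum.map₁ here (near p)
    }

  weight-++ : ∀ as bs → weight (as ++ bs) ≡ weight as + weight bs
  weight-++ as bs = trans (cong sum (map-++ proj₂ as bs)) (sum-++ (map proj₂ as) (map proj₂ bs))

  cover-trans : ∀ {P X Y a b} → Cover P X a → Cover X Y b → Cover P Y (a + b)
  cover-trans C D = record
    { balls   = balls C ++ balls D
    ; valid   = All.++⁺ (valid C) (valid D)
    ; weight≤ = ≤-trans (≤-reflexive (weight-++ (balls C) (balls D))) (+-mono-≤ (weight≤ C) (weight≤ D))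
    ; reach   = λ p → [ (λ q → inj₁ (Any.++⁺ˡ q))
                      , (λ x → Sum.map₁ (Any.++⁺ʳ (balls C)) (reach D x)) ]′ (reach C p)
    }

  cover-∪ : ∀ {P Q X a b} → Cover P X a → Cover Q X b → Cover (P ∪ Q) X (a + b)
  cover-∪ {P} {Q} {X} C D = cover-trans {X = Q ∪ X}
    (cover-weaken (Sum.map₂ inj₁) inj₂ ≤-refl C) (cover-weaken (λ q → q) (λ x → x) ≤-refl D)

  -- The rate of the theorem, `(k + 2) / (3 * (k + 1))` per vertex, cleared of denominators; `m` is
  -- the number of vertices charged.
  Cheap : (P X : Pred V 0ℓ) → ℕ → Set
  Cheap P X m = ∃[ c ] (Cover P X c × 3 * suc k * c ≤ (k + 2) * m)

  cheap-trans : ∀ {P X Y a b} → Cheap P X a → Cheap X Y b → Cheap P Y (a + b)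
  cheap-trans {a = a} {b} (c , C , p) (d , D , q) = c + d , cover-trans C D ,
    subst₂ _≤_ (sym (*-distribˡ-+ (3 * suc k) c d)) (sym (*-distribˡ-+ (k + 2) a b)) (p ⊞ q)

  cheap-∪ : ∀ {P Q X a b} → Cheap P X a → Cheap Q X b → Cheap (P ∪ Q) X (a + b)
  cheap-∪ {a = a} {b} (c , C , p) (d , D , q) = c + d , cover-∪ C D ,
    subst₂ _≤_ (sym (*-distribˡ-+ (3 * suc k) c d)) (sym (*-distribˡ-+ (k + 2) a b)) (p ⊞ q)

  cheap-⊆ : ∀ {P P′ X X′ m} → P′ ⊆ (P ∪ X′) → X ⊆ X′ → Cheap P X m → Cheap P′ X′ m
  cheap-⊆ P′⊆ X⊆ (c , C , p) = c , cover-weaken P′⊆ X⊆ ≤-refl C , p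

  cover⇒cheap : ∀ {P X c} m x → Cover P X c → 3 * c ≤ m + x → x * suc k ≤ m → Cheap P X m
  cover⇒cheap {c = c} m x C 3c≤ x≤ = c , C ,
    budget c m x k 3c≤ x≤

  -- Balls centred on a path.

  -- On a path of length h ending in v, balls of radius r ≥ ρ centred at position r, counted from
  -- the far end, contain Q; for r > h the centre is v itself.
  record Span (v : V) (Q : Pred V 0ℓ) (ρ h : ℕ) : Set where
    field
      depth  : ∀ {u} → Q u → Near h u v
      centre : ∀ r → ρ ≤ r → ∃[ w ] (Near (h ∸ r) w v × (∀ {u} → Q u → Near r u w))
  open Span

  -- A point within `e` of `v` is reached through `v`, which needs `e + (h ∸ r) ≤ r`; this follows
  -- from `h + e ≤ 2 * ρ′` and `e ≤ h`.
  span-absorb : ∀ {v Q P ρ ρ′ h e} → Span v Q ρ h → ρ ≤ ρ′ → e ≤ h → h + e ≤ 2 * ρ′ →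
    P ⊆ (λ u → Q u ⊎ Near e u v) → Span v P ρ′ h
  span-absorb {v} {Q} {P} {ρ} {ρ′} {h} {e} S ρ≤ρ′ e≤h h+e≤ P⊆ = record
    { depth  = λ p → [ depth S , near-≤ e≤h ]′ (P⊆ p)
    ; centre = centre′
    }
    where
    fits : ∀ r → ρ′ ≤ r → e + (h ∸ r) ≤ r
    fits r ρ′≤r = reach-fits e h r (≤-trans (shorter-half e h ρ′ e≤h h+e≤) ρ′≤r) (≤-trans h+e≤ (2 ⊠ ρ′≤r))

    centre′ : ∀ r → ρ′ ≤ r → ∃[ w ] (Near (h ∸ r) w v × (∀ {u} → P u → Near r u w))
    centre′ r ρ′≤r with centre S r (≤-trans ρ≤ρ′ ρ′≤r)
    ... | w , near , reaches = w , near , λ p →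
      [ reaches , (λ u∼v → near-≤ (fits r ρ′≤r) (near-trans u∼v (near-sym near))) ]′ (P⊆ p)

  span-ball : ∀ {v Q ρ h e r} → Span v Q ρ h → 1 ≤ r → r ≤ k → ρ ≤ r → e ≤ r → h + e ≤ 2 * r →
    Cover (λ u → Q u ⊎ Near e u v) ∅ r
  span-ball {h = h} {e} {r} S 1≤r r≤k ρ≤r e≤r h+e≤ with centre S r ρ≤r
  ... | w , near , reaches = cover-ball w 1≤r r≤k λ p → inj₁
    ([ reaches , (λ u∼v → near-≤ (reach-fits e h r e≤r h+e≤) (near-trans u∼v (near-sym near))) ]′ p)

  span-cover : ∀ {v Q ρ h} → 1 ≤ ρ → ρ ≤ k → Span v Q ρ h → Cover Q ∅ ρ
  span-cover 1≤ρ ρ≤k S with centre S _ ≤-refl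
  ... | w , _ , reaches = cover-ball w 1≤ρ ρ≤k λ q → inj₁ (reaches q)

  span-up : ∀ {z v Q ρ t} → z ~ v → Span v Q ρ t → Span z Q ρ (suc t)
  span-up {z} {v} {Q} {ρ} {t} e S = record
    { depth  = λ q → near-up e (depth S q)
    ; centre = centre′
    }
    where
    centre′ : ∀ r → ρ ≤ r → ∃[ w ] (Near (suc t ∸ r) w z × (∀ {u} → Q u → Near r u w))
    centre′ r ρ≤r with ≤-<-connex r t
    -- A radius exceeding `t` makes `suc t ∸ r` zero, so the centre is `z` itself.
    ... | inj₂ t<r = z , near-refl , λ q → near-≤ t<r (near-up e (depth S q))
    ... | inj₁ r≤t with centre S r ρ≤r
    ...   | w , near , reaches = w , subst (λ d → Near d w z) (sym (+-∸-assoc 1 r≤t)) (near-up e near) , reaches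

  -- Blocks of types A and B.

  -- Model case: on a path of length t with top v, one ball of radius c takes care of the lowest
  -- levels, and what it leaves lies within distance d of v.
  Peel : (v : V) (Q : Pred V 0ℓ) (ρ t κ : ℕ) → Set
  Peel v Q ρ t κ = ∀ c d → c + ρ ≤ κ → t < d + 2 * c → Cover Q (λ u → Near d u v) c

  -- `small` says that excess 2 is not yet affordable; `slack` asks for one more than reaching the
  -- parent takes. The next two fields serve `split-A`: `ρ≤1+t` keeps `h b ∸ ρ` untruncated, and
  -- `2ρ≤t+k` keeps the distance left after peeling within `k`.
  record TypeA (v : V) (Q : Pred V 0ℓ) (m ρ t : ℕ) : Set where
    constructor typeA
    field
      size  : m + 2 ≡ 3 * ρ
      small : m ≤ 2 * k + 1
      slack : 2 + t ≤ 2 * ρ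
      ρ≤1+t : ρ ≤ suc t
      2ρ≤t+k : 2 * ρ ≤ t + k
      peel  : Peel v Q ρ t (suc t)

  record TypeB (v : V) (Q : Pred V 0ℓ) (m ρ t : ℕ) : Set where
    constructor typeB
    field
      size  : m + 1 ≡ 3 * ρ
      small : m ≤ k
      slack : 1 + t ≤ 2 * ρ
      peel  : Peel v Q ρ t t

  record Block (v : V) (Q : Pred V 0ℓ) (m : ℕ) : Set where
    constructor block
    field
      {ρ t} : ℕ
      span  : Span v Q ρ t
      type  : TypeA v Q m ρ t ⊎ TypeB v Q m ρ t

  record Branch (z : V) : Set₁ where
    field
      root  : V
      edge  : z ~ root
      Q     : Pred V 0ℓ
      m     : ℕ
      inner : Block root Q m
    open Block inner public
    h : ℕ
    h = suc t
    outer : Span z Q ρ h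
    outer = span-up edge span
  open Branch using (Q; m; h)

  mass : ∀ {z} → List (Branch z) → ℕ
  mass xs = sum (map m xs)

  ⋃ : ∀ {z} → List (Branch z) → Pred V 0ℓ
  ⋃ []       = ∅
  ⋃ (b ∷ xs) = Q b ∪ ⋃ xs

  Hanging : ∀ z → List (Branch z) → Pred V 0ℓ
  Hanging z xs = ｛ z ｝ ∪ ⋃ xs

  Sorted : ∀ {z} → List (Branch z) → Set₁
  Sorted = AllPairs (λ a b → h b ≤ h a)

  Below : ∀ {z} → ℕ → List (Branch z) → Set₁
  Below e = All (λ b → h b ≤ e)

  Resolved : V → Pred V 0ℓ → ℕ → Set
  Resolved z P m = Cheap P ∅ m ⊎ Block z P m

  module _ {z : V} (b : Branch z) where
    open Branch b hiding (Q; m; h)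

    excess : ℕ
    excess = [ (λ _ → 2) , (λ _ → 1) ]′ type

    branch-size : m b + excess ≡ 3 * ρ
    branch-size with type
    ... | inj₁ A = TypeA.size A
    ... | inj₂ B = TypeB.size B

    -- The larger excess of type A comes with one more unit of slack, so one inequality serves both
    -- types.
    branch-slack : h b + excess ≤ suc (2 * ρ)
    branch-slack with type
    ... | inj₁ A = s≤s (≤-trans (≤-reflexive (+-comm t 2)) (TypeA.slack A))
    ... | inj₂ B = s≤s (≤-trans (≤-reflexive (+-comm t 1)) (TypeB.slack B))

    1≤excess : 1 ≤ excess
    1≤excess with type
    ... | inj₁ _ = s≤s z≤n
    ... | inj₂ _ = s≤s z≤n

    branch-1≤ρ : 1 ≤ ρ
    branch-1≤ρ = 1≤radius (m b) excess ρ branch-size 1≤excess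

    branch-ρ≤k : ρ ≤ k
    branch-ρ≤k with type
    ... | inj₁ A = radiusA≤k (m b) ρ k 3≤k (TypeA.size A) (TypeA.small A)
    ... | inj₂ B = radiusB≤k (m b) ρ k (TypeB.size B) (TypeB.small B)

    peel-up : ∀ {c d} → Cover (Q b) (λ u → Near d u root) c → Cover (Q b) (λ u → Near (suc d) u z) c
    peel-up = cover-weaken inj₁ (near-up edge) ≤-refl

  -- Vertices with at most one branch.

  leaf : ∀ z → Block z (Hanging z []) 1
  leaf z = block {ρ = 1} {t = 0}
    (record { depth = at-z ; centre = λ r 1≤r → z , near-refl , at-z })
    (inj₁ (typeA refl (m≤n+m 1 (2 * k)) ≤-refl ≤-refl (≤-trans (n≤1+n 2) 3≤k)
      -- Peeling takes no ball: the only vertex is within every distance of `z`.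
      λ c d _ _ → cover-weaken inj₁ (λ x → x) z≤n (cover-⊆ at-z)))
    where
    at-z : ∀ {d u} → Hanging z [] u → Near d u z
    at-z (inj₁ refl) = near-refl

  -- Adding `z` lowers the excess by one at the same radius: type A turns into type B or becomes
  -- affordable, and type B is paid for in full.
  stem : ∀ {z} (a : Branch z) → Resolved z (Hanging z (a ∷ [])) (suc (mass (a ∷ [])))
  stem {z} a = go type
    where
    open Branch a hiding (Q; m; h)

    join : h a ≤ 2 * ρ → Span z (Hanging z (a ∷ [])) ρ (h a)
    join h≤2ρ = span-absorb outer ≤-refl z≤n (≤-trans (≤-reflexive (+-identityʳ (h a))) h≤2ρ)
      λ { (inj₁ refl) → inj₂ near-refl ; (inj₂ (inj₁ q)) → inj₁ q }

    cheap : ∀ x → h a ≤ 2 * ρ → 3 * ρ ≤ suc (m a + 0) + x → x * suc k ≤ suc (m a + 0) →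
      Resolved z (Hanging z (a ∷ [])) (suc (mass (a ∷ [])))
    cheap x h≤2ρ 3ρ≤ x≤ =
      inj₁ (cover⇒cheap _ x (span-cover (branch-1≤ρ a) (branch-ρ≤k a) (join h≤2ρ)) 3ρ≤ x≤)

    go : TypeA root (Q a) (m a) ρ t ⊎ TypeB root (Q a) (m a) ρ t →
      Resolved z (Hanging z (a ∷ [])) (suc (mass (a ∷ [])))
    go (inj₂ B) = cheap 0 (TypeB.slack B) (stem-costB (m a) ρ (TypeB.size B)) z≤n
    go (inj₁ A) with ≤-<-connex (suc (m a + 0)) k
    ... | inj₂ k< = cheap 1 (<⇒≤ (TypeA.slack A)) (≤-reflexive (sym (stem-size (m a) ρ (TypeA.size A))))
                      (≤-trans (≤-reflexive (+-identityʳ (suc k))) k<)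
    ... | inj₁ ≤k = inj₂ (block (join (<⇒≤ (TypeA.slack A)))
                      (inj₂ (typeB (stem-size (m a) ρ (TypeA.size A)) ≤k (TypeA.slack A) peel)))
      where
      peel : Peel z (Hanging z (a ∷ [])) ρ (h a) (h a)
      -- Distance 0 contradicts `slack`; otherwise one unit of the distance is spent on the edge up
      -- to `z`.
      peel c zero    p q with () ← peel-positive c 0 ρ t p q (TypeA.slack A)
      peel c (suc d) p q = cover-weaken
        (λ { (inj₁ refl) → inj₂ near-refl ; (inj₂ (inj₁ x)) → inj₁ x }) (λ x → x) ≤-refl
        (peel-up a (TypeA.peel A c d p (s≤s⁻¹ q)))

  others-near : ∀ {z e} (xs : List (Branch z)) → Below e xs → ∀ {u} → ⋃ xs u → Near e u z
  others-near (b ∷ xs) (b≤ All.∷ _)  (inj₁ q) = near-≤ b≤ (depth (Branch.outer b) q)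
  others-near (b ∷ xs) (_ All.∷ xs≤) (inj₂ q) = others-near xs xs≤ q

  -- The two tallest branches within reach of one ball.

  module Joint {z : V} (a b : Branch z) (xs : List (Branch z))
               (hb≤ha : h b ≤ h a) (xs≤hb : Below (h b) xs) where
    open Branch a using () renaming (ρ to ρa; t to ta)
    open Branch b using () renaming (ρ to ρb; t to tb)

    P : Pred V 0ℓ
    P = Hanging z (a ∷ b ∷ xs)

    μ : ℕ
    μ = suc (mass (a ∷ b ∷ xs))

    P⊆ : P ⊆ (λ u → Q a u ⊎ Near (h b) u z)
    P⊆ (inj₁ refl)                   = inj₂ near-refl
    P⊆ (inj₂ (inj₁ q))               = inj₁ q
    P⊆ (inj₂ (inj₂ q))               = inj₂ (others-near (b ∷ xs) (≤-refl All.∷ xs≤hb) q)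

    joint-span : ∀ {r} → ρa ≤ r → h a + h b ≤ 2 * r → Span z P r (h a)
    joint-span ρa≤r h≤2r = span-absorb (Branch.outer a) ρa≤r hb≤ha h≤2r P⊆

    heights : h a + h b + (excess a + excess b) ≤ 2 + 2 * (ρa + ρb)
    heights = joint-heights ρa ρb (h a) (h b) (excess a) (excess b) (branch-slack a) (branch-slack b)

    heights₃ : 3 ≤ excess a + excess b → suc (h a + h b) ≤ 2 * (ρa + ρb)
    heights₃ 3≤x = s≤s⁻¹ (s≤s⁻¹ (≤-trans (≤-reflexive (+-comm 3 (h a + h b))) (≤-trans (+-monoʳ-≤ (h a + h b) 3≤x) heights)))

    heights₂ : h a + h b ≤ 2 * (ρa + ρb)
    heights₂ = s≤s⁻¹ (s≤s⁻¹ (≤-trans (≤-reflexive (+-comm 2 (h a + h b)))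
      (≤-trans (+-monoʳ-≤ (h a + h b) (1≤excess a ⊞ 1≤excess b)) heights)))

    module Low (r : ℕ) (ρa≤r : ρa ≤ r) (h≤2r : h a + h b ≤ 2 * r) (r≤k : r ≤ k)
               (minimal : r ≤ ρa ⊎ 2 * r ≤ suc (h a + h b)) where

      cheap : ∀ x → 3 * r ≤ μ + x → x * suc k ≤ μ → Resolved z P μ
      cheap x 3r≤ x≤ = inj₁ (cover⇒cheap μ x
        (span-cover (≤-trans (branch-1≤ρ a) ρa≤r) r≤k (joint-span ρa≤r h≤2r)) 3r≤ x≤)

      -- Two units to spare in the heights save one unit of radius, worth 3; together with `z` this
      -- pays a combined excess of 4.
      cheap-loose : excess a + excess b ≤ 4 → 2 + (h a + h b) ≤ 2 * (ρa + ρb) → Resolved z P μ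
      cheap-loose x≤4 loose = cheap 0
        (joint-cost-< r ρa ρb (m a) (m b) (mass xs) (excess a) (excess b)
          (joint-radius-< r ρa ρb (h a + h b) minimal (branch-1≤ρ b) loose)
          (branch-size a) (branch-size b) x≤4) z≤n

      cheap-rest : ∀ y → excess a + excess b ≤ suc (mass xs + y) → y * suc k ≤ μ → Resolved z P μ
      cheap-rest y x≤ y≤ = cheap y
        (joint-cost r ρa ρb (m a) (m b) (mass xs) (excess a) (excess b) y
          (joint-radius r ρa ρb (h a + h b) minimal heights₂) (branch-size a) (branch-size b) x≤) y≤

    joint-block-span : Span z P (ρa + ρb) (h a)
    joint-block-span = joint-span (m≤m+n ρa ρb) heights₂

    joint-block-size : ∀ y → excess a + excess b ≡ suc (mass xs + y) → μ + y ≡ 3 * (ρa + ρb)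
    joint-block-size y = joint-size ρa ρb (m a) (m b) (mass xs) (excess a) (excess b) y
      (branch-size a) (branch-size b)

    joint-block-slack : 2 + h a ≤ 2 * (ρa + ρb)
    joint-block-slack = joint-slack ρa ρb (h a) (excess a) (branch-slack a) (1≤excess a) (branch-1≤ρ b)

    joint-block-peel : ∀ {c d} → h b ≤ d → Cover (Q a) (λ u → Near d u z) c → Cover P (λ u → Near d u z) c
    joint-block-peel hb≤d = cover-weaken (λ p → Sum.map₂ (near-≤ hb≤d) (P⊆ p)) (λ x → x) ≤-refl

    -- `peel-depth` shows `h b ≤ d`, so everything outside `Q a` may be left over and only `a` has
    -- to be peeled.
    tight-peel :
      TypeA (Branch.root a) (Q a) (m a) ρa ta ⊎ (TypeB (Branch.root a) (Q a) (m a) ρa ta × 2 * ρa ≤ h a) →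
      suc (h a + h b) ≤ 2 * (ρa + ρb) → Peel z P (ρa + ρb) (h a) (suc (h a))
    tight-peel ty hs c d p q with peel-depth c (ρa + ρb) (h a) (h b) d p q hs
    ... | s≤s {n = d′} tb≤ = joint-block-peel (s≤s tb≤) (top ty)
      where
      c+ρa≤ha : c + ρa ≤ h a
      c+ρa≤ha = peel-cost c ρa ρb (h a) p (branch-1≤ρ b)

      top : TypeA (Branch.root a) (Q a) (m a) ρa ta ⊎ (TypeB (Branch.root a) (Q a) (m a) ρa ta × 2 * ρa ≤ h a) →
        Cover (Q a) (λ u → Near (suc d′) u z) c
      top (inj₁ A) = peel-up a (TypeA.peel A c d′ c+ρa≤ha (s≤s⁻¹ q))
      top (inj₂ (B , 2ρa≤ha)) with ≤-<-connex (c + ρa) ta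
      ... | inj₁ ≤ta = peel-up a (TypeB.peel B c d′ ≤ta (s≤s⁻¹ q))
      -- Here `h a ≤ c + ρa`, and `2 * ρa ≤ h a` gives `ρa ≤ c`: the allowance pays for a ball on
      -- all of `Q a`.
      ... | inj₂ ta< = cover-weaken inj₁ (λ ()) (full-cost c ρa (h a) ta< 2ρa≤ha)
                         (span-cover (branch-1≤ρ a) (branch-ρ≤k a) (Branch.outer a))

    peelB : TypeB (Branch.root a) (Q a) (m a) ρa ta → Peel z P (ρa + ρb) (h a) (h a)
    peelB B c d p q with peel-depth′ c (ρa + ρb) (h a) (h b) d p q heights₂
    ... | s≤s {n = d′} tb≤ = joint-block-peel (s≤s tb≤)
      (peel-up a (TypeB.peel B c d′ (peel-cost c ρa ρb ta p (branch-1≤ρ b)) (s≤s⁻¹ q)))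

    excessA : ∀ (c : Branch z) {A} → Branch.type c ≡ inj₁ A → excess c ≡ 2
    excessA c = cong [ (λ _ → 2) , (λ _ → 1) ]′

    excessB : ∀ (c : Branch z) {B} → Branch.type c ≡ inj₂ B → excess c ≡ 1
    excessB c = cong [ (λ _ → 2) , (λ _ → 1) ]′

    -- At radius `ρa + ρb` the new excess is `excess a + excess b`, minus one for `z`, minus
    -- `mass xs`. Two branches of type A are always loose. One of each type leaves `2 - mass xs`
    -- unless loose, and two of type B leave `1 - mass xs`; a positive value is affordable or makes
    -- a new block.
    low : h a + h b ≤ 2 * k → Resolved z P μ
    low h≤2k with half ρa (h a + h b) k (branch-ρ≤k a) h≤2k
    ... | r , ρa≤r , h≤2r , r≤k , minimal = go (Branch.type a) refl (Branch.type b) refl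
      where
      open Low r ρa≤r h≤2r r≤k minimal

      blockB : excess a + excess b ≡ suc (mass xs + 1) → Peel z P (ρa + ρb) (h a) (h a) → Resolved z P μ
      blockB x≡ peel with ≤-<-connex μ k
      ... | inj₁ μ≤k = inj₂ (block joint-block-span
                         (inj₂ (typeB (joint-block-size 1 x≡) μ≤k (<⇒≤ joint-block-slack) peel)))
      ... | inj₂ k<μ = cheap-rest 1 (≤-reflexive x≡) (≤-trans (≤-reflexive (+-identityʳ (suc k))) k<μ)

      blockA : excess a + excess b ≡ suc (mass xs + 2) → 2 * (ρa + ρb) ≤ suc (h a + h b) →
        Peel z P (ρa + ρb) (h a) (suc (h a)) → Resolved z P μ
      blockA x≡ tight peel with ≤-<-connex (2 * suc k) μ
      ... | inj₁ ≤μ = cheap-rest 2 (≤-reflexive x≡) ≤μ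
      ... | inj₂ μ< = inj₂ (block joint-block-span (inj₁ (typeA size μ≤ joint-block-slack
                        (m≤n⇒m≤1+n ρ≤ha) (double-≤ (ρa + ρb) (h a) k ρ≤ha (radiusA≤k μ (ρa + ρb) k 3≤k size μ≤)) peel)))
        where
        size : μ + 2 ≡ 3 * (ρa + ρb)
        size = joint-block-size 2 x≡
        μ≤ : μ ≤ 2 * k + 1
        μ≤ = s≤s⁻¹ (≤-trans μ< (≤-reflexive (double-suc k)))
        -- Tightness bounds the radius by the taller branch, which yields both `ρ≤1+t` and `2ρ≤t+k`.
        ρ≤ha : ρa + ρb ≤ h a
        ρ≤ha = joint-radius≤height (ρa + ρb) (h a) (h b) tight hb≤ha

      mixed : excess a + excess b ≡ 3 →
        (2 * (ρa + ρb) ≤ suc (h a + h b) →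
          TypeA (Branch.root a) (Q a) (m a) ρa ta ⊎ (TypeB (Branch.root a) (Q a) (m a) ρa ta × 2 * ρa ≤ h a)) →
        Resolved z P μ
      mixed x≡3 ty with ≤-<-connex (2 + (h a + h b)) (2 * (ρa + ρb))
      ... | inj₁ loose = cheap-loose (≤-trans (≤-reflexive x≡3) (n≤1+n 3)) loose
      ... | inj₂ tight = rest (mass xs) refl
        where
        strong : Peel z P (ρa + ρb) (h a) (suc (h a))
        strong = tight-peel (ty (s≤s⁻¹ tight)) (heights₃ (≤-reflexive (sym x≡3)))
        rest : ∀ M → mass xs ≡ M → Resolved z P μ
        rest 0 eq = blockA (trans x≡3 (cong (λ M → suc (M + 2)) (sym eq))) (s≤s⁻¹ tight) strong
        rest 1 eq = blockB (trans x≡3 (cong (λ M → suc (M + 1)) (sym eq)))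
                      λ c d p → strong c d (m≤n⇒m≤1+n p)
        rest (suc (suc M)) eq = cheap-rest 0
          (≤-trans (≤-reflexive x≡3) (s≤s (≤-trans (≤-trans (m≤m+n 2 M) (≤-reflexive (sym eq))) (m≤m+n (mass xs) 0)))) z≤n

      go : ∀ ta → Branch.type a ≡ ta → ∀ tb → Branch.type b ≡ tb → Resolved z P μ
      go (inj₁ A) ea (inj₁ A′) eb = cheap-loose (≤-reflexive x≡4)
          (s≤s⁻¹ (s≤s⁻¹ (≤-trans (≤-reflexive (+-comm 4 (h a + h b))) (subst (λ x → h a + h b + x ≤ 2 + 2 * (ρa + ρb)) x≡4 heights))))
        where
        x≡4 : excess a + excess b ≡ 4
        x≡4 = cong₂ _+_ (excessA a ea) (excessA b eb)
      go (inj₁ A) ea (inj₂ B) eb = mixed (cong₂ _+_ (excessA a ea) (excessB b eb)) λ _ → inj₁ A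
      go (inj₂ B) ea (inj₁ A) eb = mixed (cong₂ _+_ (excessB a ea) (excessA b eb)) λ tight →
        inj₂ (B , tight-height ρa ρb (h a) (h b) tight
          (subst (λ x → h b + x ≤ suc (2 * ρb)) (excessA b eb) (branch-slack b)))
      go (inj₂ B) ea (inj₂ B′) eb = rest (mass xs) refl
        where
        x≡2 : excess a + excess b ≡ 2
        x≡2 = cong₂ _+_ (excessB a ea) (excessB b eb)
        rest : ∀ M → mass xs ≡ M → Resolved z P μ
        rest 0       eq = blockB (trans x≡2 (cong (λ M → suc (M + 1)) (sym eq))) (peelB B)
        rest (suc M) eq = cheap-rest 0
          (≤-trans (≤-reflexive x≡2) (s≤s (≤-trans (≤-trans (m≤m+n 1 M) (≤-reflexive (sym eq))) (m≤m+n (mass xs) 0)))) z≤n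

  -- Peeling the branches when one ball is too small.

  CostA : (p c R M : ℕ) → Set
  CostA zero    c R M = c ≡ 0 × R ≡ 0
  -- Each branch of type A gains one unit, counted by `suc p`. `2 ≤ R` lets the next branch gain its
  -- unit, and `R ≤ k` makes `R` an admissible strength.
  CostA (suc p) c R M = 2 ≤ R × R ≤ k × 3 * c + (3 * R + suc p) ≤ M + 6

  -- `h′` bounds the distance from `z` of the other branches of type B; `N` is the radius of `top`,
  -- plus that of the next tallest of them if there is one.
  record Top (z : V) (H : ℕ) (P : Pred V 0ℓ) (M : ℕ) : Set₁ where
    field
      top    : Branch z
      isB    : TypeB (Branch.root top) (Q top) (m top) (Branch.ρ top) (Branch.t top)
      h≤H    : h top ≤ H
      h′ N   : ℕ
      P⊆     : P ⊆ (λ u → Q top u ⊎ Near h′ u z)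
      h′≤h   : h′ ≤ h top
      h+h′≤  : h top + h′ ≤ 2 * N
      3N≤    : 3 * N ≤ M + 2
      m≤     : m top ≤ M

  data PartB (z : V) (H : ℕ) (P : Pred V 0ℓ) (M : ℕ) : ℕ → Set₁ where
    none : P ⊆ ∅ → PartB z H P M 0
    some : ∀ {q} → Top z H P M → PartB z H P M (suc q)

  -- p branches of type A, peeled down to distance R from z, and q branches of type B.
  record Split {z : V} (H : ℕ) (xs : List (Branch z)) (p q : ℕ) : Set₁ where
    field
      {c R MA MB} : ℕ
      {PB}        : Pred V 0ℓ
      cover       : Cover (⋃ xs) (λ u → Near R u z ⊎ PB u) c
      masses      : MA + MB ≡ mass xs
      costA       : CostA p c R MA
      partB       : PartB z H PB MB q

  partB-≤ : ∀ {z H H′ P M q} → H ≤ H′ → PartB z H P M q → PartB z H′ P M q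
  partB-≤ H≤ (none P⊆)  = none P⊆
  partB-≤ H≤ (some top) = some (record { Top top ; h≤H = ≤-trans (Top.h≤H top) H≤ })

  split-A : ∀ {z H p q xs} (b : Branch z) →
    TypeA (Branch.root b) (Q b) (m b) (Branch.ρ b) (Branch.t b) → h b ≤ H →
    Split (h b) xs p q → Split H (b ∷ xs) (suc p) q
  split-A {z} {p = p} {xs = xs} b A b≤H S = record
    { cover  = cover-weaken inj₁ (λ { (inj₁ near) → inj₁ near ; (inj₂ x) → inj₂ x }) ≤-refl
                 (cover-∪ (cover-weaken inj₁ (λ near → inj₁ (near-≤ (m≤n⊔m R (suc d)) near)) ≤-refl peeled)
                   (cover-weaken inj₁ (Sum.map₁ (near-≤ (m≤m⊔n R (suc d)))) ≤-refl cover))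
    ; masses = trans (+-assoc (m b) MA MB) (cong (m b +_) masses)
    ; costA  = cost-A p costA
    ; partB  = partB-≤ b≤H partB
    }
    where
    open Split S
    open TypeA A
    open Branch b using (ρ; t; root)
    cb d : ℕ
    -- This choice meets the constraints of `peel` with equality: `cb + ρ ≡ h b` and
    -- `d + 2 * cb ≡ h b`.
    cb = h b ∸ ρ
    d  = 2 * ρ ∸ h b
    cb+ρ≡h : cb + ρ ≡ h b
    cb+ρ≡h = m∸n+n≡m ρ≤1+t
    d+h≡2ρ : d + h b ≡ 2 * ρ
    d+h≡2ρ = m∸n+n≡m (<⇒≤ slack)
    1≤d : 1 ≤ d
    1≤d = peel-1≤ d ρ (h b) slack d+h≡2ρ
    d<k : suc d ≤ k
    d<k = peel-≤k d ρ t k 2ρ≤t+k d+h≡2ρ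
    peeled : Cover (Q b) (λ u → Near (suc d) u z) cb
    peeled = peel-up b (peel cb d (≤-reflexive cb+ρ≡h) (peel-level cb d ρ (h b) cb+ρ≡h d+h≡2ρ))
    cost-A : ∀ p → CostA p c R MA → CostA (suc p) (cb + c) (R ⊔ suc d) (m b + MA)
    cost-A zero (refl , refl) = s≤s 1≤d , d<k , first-cost cb d ρ (h b) (m b) MA cb+ρ≡h d+h≡2ρ size
    cost-A (suc p) (2≤R , R≤k , c≤) = ≤-trans 2≤R (m≤m⊔n R (suc d)) , ⊔-lub R≤k d<k
      , next-cost c R (suc p) cb d ρ (h b) (m b) MA cb+ρ≡h d+h≡2ρ size 1≤d 2≤R c≤

  split-B : ∀ {z H p q xs} (b : Branch z) →
    TypeB (Branch.root b) (Q b) (m b) (Branch.ρ b) (Branch.t b) → h b ≤ H →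
    Split (h b) xs p q → Split H (b ∷ xs) p (suc q)
  split-B {z} {H} {xs = xs} b B b≤H S = record
    { PB     = Q b ∪ PB
    ; cover  = cover-weaken (λ { (inj₁ q) → inj₂ (inj₂ (inj₁ q)) ; (inj₂ q) → inj₁ q })
                 (Sum.map₂ inj₂) ≤-refl cover
    ; masses = trans (+-exchange MA (m b) MB) (cong (m b +_) masses)
    ; costA  = costA
    ; partB  = some (new partB)
    }
    where
    open Split S
    open TypeB B
    open Branch b using (ρ)
    new : ∀ {q} → PartB z (h b) PB MB q → Top z H (Q b ∪ PB) (m b + MB)
    new (none PB⊆∅) = record
      { top = b ; isB = B ; h≤H = b≤H ; h′ = 0 ; N = ρ
      ; P⊆    = λ { (inj₁ q) → inj₁ q ; (inj₂ x) → ⊥-elim (PB⊆∅ x) }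
      ; h′≤h  = z≤n
      ; h+h′≤ = ≤-trans (≤-reflexive (+-identityʳ (h b))) slack
      ; 3N≤   = ≤-trans (≤-reflexive (sym size)) (m≤m+n (m b) MB ⊞ n≤1+n 1)
      ; m≤    = m≤m+n (m b) MB
      }
    new (some T) = record
      { top = b ; isB = B ; h≤H = b≤H ; h′ = h top ; N = ρ + Branch.ρ top
      ; P⊆    = λ { (inj₁ q) → inj₁ q
                  ; (inj₂ x) → inj₂ ([ depth (Branch.outer top) , near-≤ h′≤h ]′ (P⊆ x)) }
      ; h′≤h  = h≤H
      ; h+h′≤ = ≤-trans (slack ⊞ TypeB.slack isB) (≤-reflexive (sym (*-distribˡ-+ 2 ρ (Branch.ρ top))))
      ; 3N≤   = pair-cost (m b) (m top) MB ρ (Branch.ρ top) size (TypeB.size isB) m≤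
      ; m≤    = m≤m+n (m b) MB
      }
      where open Top T

  split : ∀ {z H} (xs : List (Branch z)) → Below H xs → Sorted xs → ∃₂ (Split H xs)
  split [] _ _ = 0 , 0 , record
    { MA = 0 ; MB = 0 ; cover = cover-⊆ {X = λ u → Near 0 u _ ⊎ ∅ u} (λ ()) ; masses = refl ; costA = refl , refl ; partB = none (λ ()) }
  split (b ∷ xs) (b≤H All.∷ _) (xs≤ AllPairs.∷ sorted) with split xs xs≤ sorted
  ... | p , q , S with Branch.type b
  ...   | inj₁ A = suc p , q , split-A b A b≤H S
  ...   | inj₂ B = p , suc q , split-B b B b≤H S

  -- One ball on the path of `top` takes the branches of type B together with the distance `R`
  -- around `z`. The constants leave `6 - 1 - 2`, of which `z` pays one: excess 2.
  cheap-mixed : ∀ {z H p q} {xs : List (Branch z)} → Split H xs (suc p) (suc q) →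
    2 * suc k ≤ suc (mass xs) → Cheap (Hanging z xs) ∅ (suc (mass xs))
  cheap-mixed {z} {H} {p} {xs = xs} S large with Split.costA S | Split.partB S
  ... | 2≤R , R≤k , costA | some T = go (half (ρ ⊔ R) (h top + (h′ ⊔ R)) k (⊔-lub (branch-ρ≤k top) R≤k) fits)
    where
    open Split S hiding (costA)
    open Top T
    open Branch top using (ρ)
    h≤k : h top ≤ k
    h≤k = heightB≤k (h top) ρ (m top) k (TypeB.slack isB) (TypeB.size isB) (TypeB.small isB)
    fits : h top + (h′ ⊔ R) ≤ 2 * k
    fits = ≤-trans (h≤k ⊞ ⊔-lub (≤-trans h′≤h h≤k) R≤k) (≤-reflexive (cong (k +_) (sym (+-identityʳ k))))
    go : ∃[ r ] (ρ ⊔ R ≤ r × h top + (h′ ⊔ R) ≤ 2 * r × r ≤ k × (r ≤ ρ ⊔ R ⊎ 2 * r ≤ suc (h top + (h′ ⊔ R)))) →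
      Cheap (Hanging z xs) ∅ (suc (mass xs))
    go (r , ρ⊔R≤r , h≤2r , r≤k , minimal) = cover⇒cheap (suc (mass xs)) 2
      (cover-trans {X = λ u → Near R u z ⊎ PB u}
        (cover-weaken (λ { (inj₁ refl) → inj₂ (inj₁ near-refl) ; (inj₂ x) → inj₁ x }) (λ x → x) ≤-refl cover)
        (cover-weaken
          (λ { (inj₁ near) → inj₁ (inj₂ (near-≤ (m≤n⊔m h′ R) near))
             ; (inj₂ x)    → inj₁ (Sum.map₂ (near-≤ (m≤m⊔n h′ R)) (P⊆ x)) }) (λ ()) ≤-refl
          (span-ball (Branch.outer top) (≤-trans (branch-1≤ρ top) ρ≤r) r≤k ρ≤r
            (⊔-lub (shorter-half h′ (h top) r h′≤h (≤-trans (+-monoʳ-≤ (h top) (m≤m⊔n h′ R)) h≤2r))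
                   (≤-trans (m≤n⊔m ρ R) ρ⊔R≤r))
            h≤2r)))
      (mixed-cost c r R p MA MB (mass xs) costA
        (top-cost r ρ R (h top) h′ N MB 2≤R
          (≤-trans (2≤sizeB (m top) ρ (TypeB.size isB) (branch-1≤ρ top)) m≤)
          (TypeB.slack isB) (≤-trans (≤-reflexive (sym (TypeB.size isB))) (+-monoˡ-≤ 1 m≤)) h+h′≤ 3N≤ minimal)
        masses)
      large
      where
      ρ≤r : ρ ≤ r
      ρ≤r = ≤-trans (m≤m⊔n ρ R) ρ⊔R≤r

  -- A ball of radius `R` at `z` takes what peeling leaves. Two branches of type A reduce the
  -- constant 6 to 4, of which `z` pays one: excess 3.
  cheap-pure : ∀ {z H p} {xs : List (Branch z)} → Split H xs (suc (suc p)) 0 →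
    3 * suc k ≤ suc (mass xs) → Cheap (Hanging z xs) ∅ (suc (mass xs))
  cheap-pure {z} {H} {p} {xs} S large with Split.costA S | Split.partB S
  ... | 2≤R , R≤k , costA | none PB⊆∅ = cover⇒cheap (suc (mass xs)) 3
      (cover-trans {X = λ u → Near R u z ⊎ PB u}
        (cover-weaken (λ { (inj₁ refl) → inj₂ (inj₁ near-refl) ; (inj₂ x) → inj₁ x }) (λ x → x) ≤-refl cover)
        (cover-ball z (≤-trans (n≤1+n 1) 2≤R) R≤k λ { (inj₁ near) → inj₁ near ; (inj₂ x) → ⊥-elim (PB⊆∅ x) }))
      (pure-cost c R p MA MB (mass xs) costA masses)
      large
    where open Split S hiding (costA)

  -- `a` has type A by `tall-not-B`. Excess 3 arises only when every branch has type A, and then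
  -- `tall-AA` provides the `3 * suc k` vertices.
  tall : ∀ {z} (a b : Branch z) xs → h b ≤ h a → Below (h b) xs → Sorted xs →
    2 * k < h a + h b → Cheap (Hanging z (a ∷ b ∷ xs)) ∅ (suc (mass (a ∷ b ∷ xs)))
  tall a b xs hb≤ha xs≤hb sorted 2k< with split xs xs≤hb sorted | Branch.type a | Branch.type b
  ... | _ , _ , _ | inj₂ B | _
    with () ← tall-not-B (h a) (h b) (Branch.ρ a) (m a) k 2k< hb≤ha (TypeB.slack B) (TypeB.size B) (TypeB.small B) 3≤k
  ... | p , zero , S | inj₁ A | inj₁ A′ = cheap-pure (split-A a A ≤-refl (split-A b A′ hb≤ha S))
    (tall-AA (h a) (h b) (Branch.ρ a) (Branch.ρ b) (m a) (m b) (mass xs) k 2k<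
      (TypeA.slack A) (TypeA.slack A′) (TypeA.size A) (TypeA.size A′))
  ... | p , suc q , S | inj₁ A | inj₁ A′ = cheap-mixed (split-A a A ≤-refl (split-A b A′ hb≤ha S))
    (≤-trans (*-monoˡ-≤ (suc k) (n≤1+n 2))
      (tall-AA (h a) (h b) (Branch.ρ a) (Branch.ρ b) (m a) (m b) (mass xs) k 2k<
        (TypeA.slack A) (TypeA.slack A′) (TypeA.size A) (TypeA.size A′)))
  ... | p , q , S | inj₁ A | inj₂ B = cheap-mixed (split-A a A ≤-refl (split-B b B hb≤ha S))
    (tall-AB (h a) (h b) (Branch.ρ a) (Branch.ρ b) (m a) (m b) (mass xs) k 3≤k 2k<
      (TypeA.slack A) (TypeB.slack B) (TypeA.size A) (TypeB.size B))

  resolve : ∀ {z} (xs : List (Branch z)) → Sorted xs → Resolved z (Hanging z xs) (suc (mass xs))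
  resolve []           _ = inj₂ (leaf _)
  resolve (a ∷ [])     _ = stem a
  resolve (a ∷ b ∷ xs) ((hb≤ha All.∷ _) AllPairs.∷ xs≤hb AllPairs.∷ sorted) with ≤-<-connex (h a + h b) (2 * k)
  ... | inj₁ ≤2k = Joint.low a b xs hb≤ha xs≤hb ≤2k
  ... | inj₂ 2k< = inj₁ (tall a b xs hb≤ha xs≤hb sorted 2k<)

  -- Processing a rooted tree from the leaves upwards.

  record Inserted {z : V} (b : Branch z) (xs ys : List (Branch z)) : Set₁ where
    field
      sorted  : Sorted ys
      mass≡   : mass ys ≡ m b + mass xs
      ⊆ys     : (Q b ∪ ⋃ xs) ⊆ ⋃ ys
      bounded : ∀ {e} → h b ≤ e → Below e xs → Below e ys

  insert : ∀ {z} (b : Branch z) xs → Sorted xs → ∃ (Inserted b xs)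
  insert b [] _ = b ∷ [] , record
    { sorted = All.[] AllPairs.∷ AllPairs.[] ; mass≡ = refl ; ⊆ys = λ q → q ; bounded = All._∷_ }
  insert b (c ∷ xs) (xs≤c AllPairs.∷ sorted) with ≤-total (h c) (h b)
  ... | inj₁ c≤b = b ∷ c ∷ xs , record
    { sorted  = (c≤b All.∷ All.map (λ ≤c → ≤-trans ≤c c≤b) xs≤c) AllPairs.∷ xs≤c AllPairs.∷ sorted
    ; mass≡   = refl
    ; ⊆ys     = λ q → q
    ; bounded = All._∷_
    }
  ... | inj₂ b≤c with insert b xs sorted
  ...   | ys , I = c ∷ ys , record
    { sorted  = bounded b≤c xs≤c AllPairs.∷ Inserted.sorted I
    ; mass≡   = trans (cong (m c +_) mass≡) (+-exchange (m c) (m b) (mass xs))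
    ; ⊆ys     = λ { (inj₁ q) → inj₂ (⊆ys (inj₁ q)) ; (inj₂ (inj₁ q)) → inj₁ q ; (inj₂ (inj₂ q)) → inj₂ (⊆ys (inj₂ q)) }
    ; bounded = λ { b≤e (c≤e All.∷ xs≤e) → c≤e All.∷ bounded b≤e xs≤e }
    }
    where open Inserted I hiding (sorted)

  -- Repeated vertices are not excluded here: costs are charged to the length of `vertices`, and
  -- `spanning` supplies distinctness.
  data Tree : V → Set where
    single : ∀ z → Tree z
    graft  : ∀ {z c} → Tree z → z ~ c → Tree c → Tree z

  vertices : ∀ {z} → Tree z → List V
  vertices (single z)    = z ∷ []
  vertices (graft T _ C) = vertices T ++ vertices C

  -- The `suc` counts `z`, which stays open until all its subtrees are grafted; `close` then settles
  -- it once.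
  record Forest (z : V) (P : Pred V 0ℓ) (s : ℕ) : Set₁ where
    field
      {done}   : ℕ
      branches : List (Branch z)
      sorted   : Sorted branches
      total    : done + suc (mass branches) ≡ s
      cheap    : Cheap P (Hanging z branches) done

  record Pending (z : V) (P : Pred V 0ℓ) (s : ℕ) : Set₁ where
    field
      {done m} : ℕ
      {Q}      : Pred V 0ℓ
      total    : done + m ≡ s
      cheap    : Cheap P Q done
      inner    : Block z Q m

  close : ∀ {z P s} → Forest z P s → Cheap P ∅ s ⊎ Pending z P s
  close {P = P} F with resolve (Forest.branches F) (Forest.sorted F)
  ... | inj₁ C = inj₁ (subst (Cheap P ∅) (Forest.total F) (cheap-trans (Forest.cheap F) C))
  ... | inj₂ B = inj₂ (record { total = Forest.total F ; cheap = Forest.cheap F ; inner = B })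

  attach : ∀ {z c P P′ s s′} → z ~ c → Forest z P s → Cheap P′ ∅ s′ ⊎ Pending c P′ s′ → Forest z (P ∪ P′) (s + s′)
  attach {s′ = s′} e F (inj₁ C) = record
    { branches = branches
    ; sorted   = sorted
    ; total    = trans (closed-total done (suc (mass branches)) s′) (cong (_+ s′) total)
    ; cheap    = cheap-∪ cheap (cheap-⊆ inj₁ (λ ()) C)
    }
    where open Forest F
  attach {z} {c} e F (inj₂ B) = record
    { branches = proj₁ inserted
    ; sorted   = Inserted.sorted (proj₂ inserted)
    ; total    = trans (cong (λ M → done + Pending.done B + suc M) mass≡)
                   (trans (open-total done (Pending.done B) (mass branches) (Pending.m B))
                     (cong₂ _+_ total (Pending.total B)))
    ; cheap    = cheap-∪ (cheap-⊆ inj₁ (Sum.map₂ (λ q → ⊆ys (inj₂ q))) cheap)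
                         (cheap-⊆ inj₁ (λ q → inj₂ (⊆ys (inj₁ q))) (Pending.cheap B))
    }
    where
    open Forest F
    branch : Branch z
    branch = record { root = c ; edge = e ; Q = Pending.Q B ; m = Pending.m B ; inner = Pending.inner B }
    inserted : ∃ (Inserted branch branches)
    inserted = insert branch branches sorted
    open Inserted (proj₂ inserted) hiding (sorted)

  forest : ∀ {z} (T : Tree z) → Forest z (_∈ vertices T) (length (vertices T))
  forest (single z) = record
    { branches = []
    ; sorted   = AllPairs.[]
    ; total    = refl
    ; cheap    = 0 , cover-⊆ (λ { (here refl) → inj₁ refl }) , ≤-reflexive (trans (*-zeroʳ (3 * suc k)) (sym (*-zeroʳ (k + 2))))
    }
  forest (graft T e C) = subst (Forest _ _) (sym (length-++ (vertices T)))
    (record { Forest F ; cheap = cheap-⊆ (λ u∈ → inj₁ (∈-++⁻ (vertices T) u∈)) (λ q → q) (Forest.cheap F) })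
    where
    F : Forest _ ((_∈ vertices T) ∪ (_∈ vertices C)) (length (vertices T) + length (vertices C))
    F = attach e (forest T) (close (forest C))

  block-cover : ∀ {z Q m} → Block z Q m → ∃[ ρ ] (Cover Q ∅ ρ × 3 * ρ ≤ m + 2)
  block-cover {m = m} (block {ρ} span (inj₁ A)) = ρ
    , span-cover (1≤radius m 2 ρ size (s≤s z≤n)) (radiusA≤k m ρ k 3≤k size small) span
    , ≤-reflexive (sym size)
    where open TypeA A
  block-cover {m = m} (block {ρ} span (inj₂ B)) = ρ
    , span-cover (1≤radius m 1 ρ size ≤-refl) (radiusB≤k m ρ k size small) span
    , ≤-trans (≤-reflexive (sym size)) (+-monoʳ-≤ m (n≤1+n 1))
    where open TypeB B

  tree-cover : ∀ {z} (T : Tree z) →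
    ∃[ c ] (Cover (_∈ vertices T) ∅ c × 3 * suc k * c ≤ (k + 2) * length (vertices T) + 2 * suc k)
  tree-cover T with close (forest T)
  ... | inj₁ (c , C , c≤) = c , C , ≤-trans c≤ (m≤m+n _ (2 * suc k))
  ... | inj₂ B with Pending.cheap B | block-cover (Pending.inner B)
  ...   | c , C , c≤ | ρ , D , 3ρ≤ = c + ρ , cover-trans C D
    , leftover-cost c ρ (Pending.done B) (Pending.m B) (length (vertices T)) k c≤ 3ρ≤ (Pending.total B)

  -- Spanning trees of connected graphs.

  root∈ : ∀ {z} (T : Tree z) → z ∈ vertices T
  root∈ (single z)    = here refl
  root∈ (graft T _ _) = ∈-++⁺ˡ (root∈ T)

  -- `w` becomes a new child of `u`, somewhere inside the list; a permutation suffices, as it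
  -- preserves length and distinctness.
  grow : ∀ {z u w} (T : Tree z) → u ∈ vertices T → u ~ w → ∃[ T′ ] (vertices {z} T′ ↭ w ∷ vertices T)
  grow {w = w} (single z) (here refl) e = graft (single z) e (single w) , swap z w ↭-refl
  grow {w = w} (graft T a C) u∈ e with ∈-++⁻ (vertices T) u∈
  ... | inj₁ u∈T with grow T u∈T e
  ...   | T′ , p = graft T′ a C , ++⁺ʳ (vertices C) p
  grow {w = w} (graft T a C) u∈ e | inj₂ u∈C with grow C u∈C e
  ...   | C′ , p = graft T a C′ , ↭-trans (++⁺ˡ (vertices T) p) (shift w (vertices T) (vertices C))

  exit : ∀ {d x y} (xs : List V) → Walk G d x y → x ∈ xs → ¬ y ∈ xs → ∃₂ λ a b → a ∈ xs × ¬ b ∈ xs × a ~ b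
  exit xs nil x∈ y∉ = ⊥-elim (y∉ x∈)
  exit xs (cons {w = w} e p) x∈ y∉ with _∈?_ Fin._≟_ w xs
  ... | yes w∈ = exit xs p w∈ y∉
  ... | no  w∉ = _ , w , x∈ , w∉ , e

  extend-unique : ∀ {w} {xs : List V} → ¬ w ∈ xs → Unique xs → Unique (w ∷ xs)
  extend-unique w∉ u = ¬Any⇒All¬ _ w∉ AllPairs.∷ u

  -- Each round adds the far end of an edge leaving the tree. With no fuel left the list has at
  -- least `n` entries, so a missing `u` would give more than `n` distinct vertices.
  spanning : Connected G → ∀ fuel {z} (T : Tree z) → Unique (vertices T) → n ≤ fuel + length (vertices T) →
    ∃[ T′ ] (Unique (vertices {z} T′) × ∀ u → u ∈ vertices T′)
  spanning conn fuel {z} T uniq enough with all? (λ u → _∈?_ Fin._≟_ u (vertices T))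
  ... | yes all = T , uniq , all
  ... | no ¬all with ¬∀⟶∃¬ n _ (λ u → _∈?_ Fin._≟_ u (vertices T)) ¬all
  ...   | u , u∉ with fuel
  ...     | zero = ⊥-elim (<⇒≱ (injective⇒≤ (unique-lookup (extend-unique u∉ uniq))) enough)
  ...     | suc fuel′ with exit (vertices T) (proj₂ (Connected.walk conn z u)) (root∈ T) u∉
  ...       | a , b , a∈ , b∉ , e with grow T a∈ e
  ...         | T′ , p = spanning conn fuel′ T′
    (Unique-resp-↭ (setoid V) (↭⇒↭ₛ (↭-sym p)) (extend-unique b∉ uniq))
    (≤-trans enough (≤-reflexive (trans (sym (+-suc fuel′ _)) (cong (fuel′ +_) (sym (↭-length p))))))

  -- From covers to broadcasts.

  strength : List (V × ℕ) → V → ℕ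
  strength []             v = 0
  -- Several balls may share a centre; the maximum stays within `k`, where a sum might not.
  strength ((w , r) ∷ bs) v = spike w r v ⊔ strength bs v

  strength≤k : ∀ {bs} → All Valid bs → ∀ v → strength bs v ≤ k
  strength≤k {[]}           All.[]                    v = z≤n
  strength≤k {(w , r) ∷ bs} ((_ , r≤k) All.∷ valid) v = ⊔-lub (≤-trans (spike-≤ w r v) r≤k) (strength≤k valid v)

  ∑-strength : ∀ bs → ∑ (strength bs) ≤ weight bs
  ∑-strength []             = ≤-reflexive (∑-zero n)
  ∑-strength ((w , r) ∷ bs) = ≤-trans
    (∑-mono-≤ (λ v → m⊔n≤m+n (spike w r v) (strength bs v)))
    (≤-trans (≤-reflexive (∑-distrib-+ (spike w r) (strength bs)))
      (≤-reflexive (∑-spike w r) ⊞ ∑-strength bs))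

  reached-strength : ∀ {bs u} → All Valid bs → Reached bs u →
    ∃[ w ] (1 ≤ strength bs w × Near (strength bs w) u w)
  reached-strength {(w , r) ∷ bs} ((1≤r , _) All.∷ _) (here near) = w , ≤-trans 1≤r r≤ , near-≤ r≤ near
    where
    r≤ : r ≤ spike w r w ⊔ strength bs w
    r≤ = ≤-trans (≤-reflexive (sym (spike-≡ w r))) (m≤m⊔n _ _)
  reached-strength {(w′ , r) ∷ bs} (_ All.∷ valid) (there p) with reached-strength valid p
  ... | w , 1≤ , near = w , ≤-trans 1≤ (m≤n⊔m (spike w′ r w) _) , near-≤ (m≤n⊔m (spike w′ r w) _) near

  γB≤ : ∀ (conn : Connected G) (1≤k : 1 ≤ k) {P c} → (∀ u → P u) → Cover P ∅ c → γB G conn k 1≤k ≤ c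
  γB≤ conn 1≤k {P} {c} all C = ≤-trans
    (proj₂ (proj₂ (broadcastNumber G conn k 1≤k)) (cost G conn f) (f , dominating , refl))
    (≤-trans (≤-reflexive (sum-cong-≗ f≡)) (≤-trans (∑-strength (balls C)) (weight≤ C)))
    where
    f : V → Fin (suc k)
    f v = fromℕ< (s≤s (strength≤k (valid C) v))
    f≡ : ∀ v → toℕ (f v) ≡ strength (balls C) v
    f≡ v = toℕ-fromℕ< (s≤s (strength≤k (valid C) v))
    dominating : Dominating G conn f
    dominating u with reach C (all u)
    ... | inj₁ reached with reached-strength (valid C) reached
    ...   | w , 1≤ , e , e≤ , p = w , subst (1 ≤_) (sym (f≡ w)) 1≤
      , ≤-trans (proj₂ (proj₂ (distance G conn u w)) e p) (subst (e ≤_) (sym (f≡ w)) e≤)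

  γB-bound : ∀ (conn : Connected G) (1≤k : 1 ≤ k) →
    3 * suc k * γB G conn k 1≤k ≤ (k + 2) * n + 2 * suc k
  γB-bound conn 1≤k with spanning conn n (single (Connected.nonempty conn)) (All.[] AllPairs.∷ AllPairs.[]) (m≤m+n n 1)
  ... | T , uniq , all with tree-cover T
  ...   | c , C , c≤ = ≤-trans (3 * suc k ⊠ γB≤ conn 1≤k all C)
    (≤-trans c≤ (+-monoˡ-≤ (2 * suc k) ((k + 2) ⊠ injective⇒≤ (unique-lookup uniq))))

-- Rounding up to the ceiling.

open import Data.Integer.Base as ℤ using (+_; -[1+_])
import Data.Integer.DivMod as ℤ
import Data.Integer.Properties as ℤ
open import Data.Rational.Unnormalised.Base using (mkℚᵘ; _/_; ceiling) renaming (_*_ to _*ᵘ_)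

-- `G < c` with `G` nonnegative would give `N + suc d ≤ suc d * c`; a negative `G` contradicts the
-- sign of `N`.
≤-quotient : ∀ c N d G → + N ℤ.≤ G ℤ.* + suc d → suc d * c < N + suc d → + c ℤ.≤ G
≤-quotient c N d (+ g) N≤ c< = ℤ.+≤+ (≮⇒≥ λ g<c → <⇒≱ c<
  (≤-trans (+-monoˡ-≤ (suc d) (ℤ.drop‿+≤+ (ℤ.≤-trans N≤ (ℤ.≤-reflexive (sym (ℤ.pos-* g (suc d)))))))
    (≤-trans (≤-reflexive (trans (+-comm (g * suc d) (suc d)) (*-comm (suc g) (suc d)))) (suc d ⊠ g<c))))
≤-quotient c N d -[1+ g ] () c<

-- `ceiling` is minus the floor of the negated fraction; negating `F * suc d ≤ - N` gives the
-- hypothesis of `≤-quotient`.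
≤-ceiling : ∀ c N d → suc d * c < N + suc d → + c ℤ.≤ ceiling (mkℚᵘ (+ N) d)
≤-ceiling c N d = ≤-quotient c N d (ℤ.- F) (subst₂ ℤ._≤_ (ℤ.neg-involutive (+ N)) (ℤ.neg-distribˡ-* F (+ suc d))
  (ℤ.neg-mono-≤ (ℤ.[n/d]*d≤n (ℤ.- + N) (+ suc d))))
  where
  F : ℤ.ℤ
  F = (ℤ.- + N) ℤ./ + suc d

theorem3 : (n : ℕ) (T : Graph n) (tree : IsTree T) (k : ℕ) (3≤k : 3 ≤ k) →
    k < rad T (IsTree.connected tree) →
    + γB T (IsTree.connected tree) k (≤-trans (s≤s z≤n) 3≤k)
    ℤ.≤ ceiling ((+ (k + 2) / suc k) *ᵘ (+ n / 3))
theorem3 n T tree k 3≤k _ = subst (λ N → + γ ℤ.≤ ceiling (mkℚᵘ N (2 + k * 3))) (ℤ.pos-* (k + 2) n)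
  (≤-ceiling γ ((k + 2) * n) (2 + k * 3)
    (bound-< γ n k (Broadcast.γB-bound T k 3≤k (IsTree.connected tree) (≤-trans (s≤s z≤n) 3≤k))))
  where
  γ : ℕ
  γ = γB T (IsTree.connected tree) k (≤-trans (s≤s z≤n) 3≤k)
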